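{- Let $u,v,w$ be words of length $N$ and suppose that there exists at least one oriented TFPL of size $N$ with boundary $(u,v;w)$. Then: (1) $|u|_0=|v|_0=|w|_0$; (2) $u\le w$ and $v\le w$; (3) $\mathrm{d}(u)+\mathrm{d}(v)\le \mathrm{d}(w)$.
   Context: Let $N\ge 1$. $G^N$ is the induced subgraph of the square lattice $\mathbb{Z}^2$ formed by $N$ consecutive, horizontally centred rows having $3,5,\dots,2N+1$ vertices from top to bottom (e.g. row $k$ from the top consists of the points $(x,-k)$, $-k\le x\le k$). It is bipartite; vertices of the same colour as the leftmost vertex of each row are called odd, the others even. Let $B_1,\dots,B_N$ be the even vertices of the bottom row, $L_1,\dots,L_N$ the leftmost vertices of the rows, and $R_1,\dots,R_N$ the rightmost vertices of the rows, each family numbered from left to right (so $L_1$ is the leftmost vertex of the bottom row and $R_1$ the rightmost vertex of the top row). A TFPL of size $N$ is a subgraph $f$ of $G^N$ (a set of edges) such that each $L_i$ and each $R_i$ has degree $0$ or $1$, each $B_i$ has degree $1$, every other vertex has degree $2$, and no path of $f$ joins two vertices $L_i,L_j$ or two vertices $R_i,R_j$. An oriented TFPL is a TFPL together with an orientation of each of its edges such that every vertex of degree $2$ has one incoming and one outgoing edge, the edges at the $L_i$ are oriented away from $L_i$, and the edges at the $R_i$ are oriented into $R_i$. A word of length $N$ is $u=u_1\cdots u_N$ with $u_i\in\{0,1\}$; $|u|_0,|u|_1$ are the numbers of $0$s and $1$s. An oriented TFPL has boundary $(u,v;w)$ if for all $i$: $u_i=1$ iff $L_i$ has degree $1$; $v_i=0$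 iff $R_i$ has degree $1$; $w_i=1$ if $B_i$ has in-degree $1$ and $w_i=0$ if $B_i$ has out-degree $1$. $\mathrm{d}(u)$ is the number of inversions of $u$, i.e. pairs $i<j$ with $u_i=1$, $u_j=0$. The partial order on words of length $N$ is: $u\le v$ iff $|u_1\cdots u_i|_1\le |v_1\cdots v_i|_1$ for all $i=1,\dots,N$. -}

module Defs where

open import Data.Bool using (Bool; true; _xor_)
open import Data.Digit using (Bit; 0b; 1b)
open import Data.Fin as Fin using (Fin; toℕ)
import Data.Fin.Properties as Fin
open import Data.Integer as ℤ using (ℤ; +_; -_)
open import Data.List using (List; []; _∷_; length; filter; filterᵇ; cartesianProduct; allFin; head; last)
open import Data.List.Membership.Propositional using (_∈_)
open import Data.List.Relation.Unary.Linked using (Linked)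
open import Data.List.Relation.Unary.Unique.Propositional using (Unique)
open import Data.Maybe using (just)
open import Data.Nat as ℕ using (ℕ; suc; _∸_)
open import Data.Product using (_×_; _,_; ∃-syntax)
open import Data.Sum using (_⊎_)
open import Data.Vec using (Vec; lookup; count; truncate)
open import Function.Bundles using (_⇔_)
open import Relation.Binary.PropositionalEquality using (_≡_; _≢_)
open import Relation.Nullary using (¬_)
open import Relation.Nullary.Decidable using (_×-dec_)

------------------------------------------------------------------------
-- Words

Word : ℕ → Set
Word N = Vec Bit N

∣_∣₀ ∣_∣₁ : ∀ {N} → Word N → ℕ
∣ u ∣₀ = count (Fin._≟ 0b) u
∣ u ∣₁ = count (Fin._≟ 1b) u

inversions : ∀ {N} → Word N → List (Fin N × Fin N)
inversions {N} u =
  filter (λ (i , j) → (i Fin.<? j) ×-dec (lookup u i Fin.≟ 1b) ×-dec (lookup u j Fin.≟ 0b))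
         (cartesianProduct (allFin N) (allFin N))

d : ∀ {N} → Word N → ℕ
d u = length (inversions u)

infix 4 _≼_

_≼_ : ∀ {N} → Word N → Word N → Set
_≼_ {N} u v = ∀ i (i≤N : i ℕ.≤ N) → ∣ truncate i≤N u ∣₁ ℕ.≤ ∣ truncate i≤N v ∣₁

------------------------------------------------------------------------
-- The graph G^N

Point : Set
Point = ℤ × ℤ

neighbours : Point → List Point
neighbours (x , y) =
  (ℤ.suc x , y) ∷ (ℤ.pred x , y) ∷ (x , ℤ.suc y) ∷ (x , ℤ.pred y) ∷ []

-- Row k from the top lies at height -k.
InG : ℕ → Point → Set
InG N (x , y) =
  ∃[ k ] 1 ℕ.≤ k × k ℕ.≤ N × y ≡ - (+ k) × - (+ k) ℤ.≤ x × x ℤ.≤ + k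

AdjacentInG : ℕ → Point → Point → Set
AdjacentInG N p q = InG N p × InG N q × q ∈ neighbours p

-- An index i : Fin N stands for the 1-based index suc (toℕ i).

-- Numbered from left to right, hence from the bottom row to the top row.
L : ∀ {N} → Fin N → Point
L {N} i = - (+ (N ∸ toℕ i)) , - (+ (N ∸ toℕ i))

-- Numbered from left to right, hence from the top row to the bottom row.
R : ∀ {N} → Fin N → Point
R i = + suc (toℕ i) , - (+ suc (toℕ i))

-- The leftmost vertex (-k , -k) of each row has even coordinate sum, so the
-- even vertices are those with odd coordinate sum; in the bottom row these
-- have abscissae -N+1, -N+3, ..., N-1.
B : ∀ {N} → Fin N → Point
B {N} i = + suc (2 ℕ.* toℕ i) ℤ.- + N , - (+ N)

------------------------------------------------------------------------
-- Triangular fully packed loop configurations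

-- A subgraph of G^N given by its set of edges.
record Subgraph (N : ℕ) : Set where
  field
    edge     : Point → Point → Bool
    edge-sym : ∀ p q → edge p q ≡ edge q p
    edge-inG : ∀ {p q} → edge p q ≡ true → AdjacentInG N p q

  Edge : Point → Point → Set
  Edge p q = edge p q ≡ true

  degree : Point → ℕ
  degree p = length (filterᵇ (edge p) (neighbours p))

  IsPath : Point → Point → List Point → Set
  IsPath p q ps = Linked Edge ps × Unique ps × head ps ≡ just p × last ps ≡ just q

  Joined : Point → Point → Set
  Joined p q = ∃[ ps ] IsPath p q ps

record TFPL (N : ℕ) : Set where
  field
    subgraph : Subgraph N

  open Subgraph subgraph public

  field
    degree-L     : ∀ (i : Fin N) → degree (L i) ≡ 0 ⊎ degree (L i) ≡ 1
    degree-R     : ∀ (i : Fin N) → degree (R i) ≡ 0 ⊎ degree (R i) ≡ 1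
    degree-B     : ∀ (i : Fin N) → degree (B i) ≡ 1
    degree-other : ∀ p → InG N p →
                   (∀ (i : Fin N) → p ≢ L i) →
                   (∀ (i : Fin N) → p ≢ R i) →
                   (∀ (i : Fin N) → p ≢ B i) →
                   degree p ≡ 2
    no-path-LL   : ∀ (i j : Fin N) → i ≢ j → ¬ Joined (L i) (L j)
    no-path-RR   : ∀ (i j : Fin N) → i ≢ j → ¬ Joined (R i) (R j)

record Orientation {N : ℕ} (f : Subgraph N) : Set where
  open Subgraph f
  field
    -- arc p q says that {p , q} is an edge oriented from p to q.
    arc          : Point → Point → Bool
    arc-edge     : ∀ {p q} → arc p q ≡ true → Edge p q
    edge-one-arc : ∀ {p q} → Edge p q → arc p q xor arc q p ≡ true

  Arc : Point → Point → Set
  Arc p q = arc p q ≡ true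

  indegree : Point → ℕ
  indegree p = length (filterᵇ (λ q → arc q p) (neighbours p))

  outdegree : Point → ℕ
  outdegree p = length (filterᵇ (λ q → arc p q) (neighbours p))

record OrientedTFPL (N : ℕ) : Set where
  field
    tfpl : TFPL N

  open TFPL tfpl public

  field
    orientation : Orientation subgraph

  open Orientation orientation public

  field
    balanced : ∀ p → degree p ≡ 2 → indegree p ≡ 1 × outdegree p ≡ 1
    L-out    : ∀ (i : Fin N) q → Edge (L i) q → Arc (L i) q
    R-in     : ∀ (i : Fin N) q → Edge q (R i) → Arc q (R i)

record HasBoundary {N : ℕ} (f : OrientedTFPL N) (u v w : Word N) : Set where
  open OrientedTFPL f
  field
    boundary-L     : ∀ i → lookup u i ≡ 1b ⇔ degree (L i) ≡ 1
    boundary-R     : ∀ i → lookup v i ≡ 0b ⇔ degree (R i) ≡ 1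
    boundary-B-in  : ∀ i → indegree (B i) ≡ 1 → lookup w i ≡ 1b
    boundary-B-out : ∀ i → outdegree (B i) ≡ 1 → lookup w i ≡ 0b

{-# OPTIONS --safe #-}
-- The arcs from odd to even vertices form a matching, and so do the arcs from even to odd vertices.
-- Superposing the first with the edges joining even vertices to their left neighbours gives
-- "blue" lattice paths, running rightwards from the L i with u_i = 0 to the B j with w_j = 0;
-- superposing the second with the edges to right neighbours gives "red" lattice paths, running
-- leftwards from the R i with v_i = 1 to the B j with w_j = 1. Counting the paths that cross a
-- diagonal yields (1) and (2), and summing over all diagonals shows that d w - d u is the number
-- of blue steps right or up and d w - d v the number of red steps left or up.
-- An inversion of w forces a red and a blue path to cross. At a crossing the two paths do not both
-- step down, since the matchings are disjoint, so one of them makes a step counted above. Hence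
-- d w ≤ (d w - d u) + (d w - d v), which is (3).
module Submission where

open import Defs
open import Algebra.Bundles using (AbelianGroup)
open import Data.Bool using (Bool; true; false; _xor_)
open import Data.Digit using (0b; 1b)
open import Data.Fin as Fin using (Fin; toℕ; fromℕ<; zero; suc)
import Data.Fin.Properties as Fin
open import Data.Integer as ℤ using (ℤ)
import Data.Integer.Properties as ℤ
open import Algebra.Properties.Group (AbelianGroup.group ℤ.+-0-abelianGroup) using (∙-cancelʳ)
import Data.Integer.Tactic.RingSolver as ℤ-Solver
open import Data.List using (List; []; _∷_; _++_; length; filter; filterᵇ; cartesianProduct; allFin; map)
open import Data.List.Properties using (map-tabulate; filter-++; length-++)
open import Data.Nat using (ℕ; zero; suc; _+_; _*_; _∸_; _≤_; _<_; z≤n; s≤s)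
open import Data.Nat.Properties
open import Data.Nat.Tactic.RingSolver using (solve-∀)
open import Data.Product using (_×_; _,_; proj₁; proj₂; ∃-syntax)
open import Data.Sum using (inj₁; inj₂)
open import Data.Vec using ([]; _∷_; lookup; truncate)
open import Function.Bundles using (module Equivalence)
open import Relation.Binary.PropositionalEquality
  using (_≡_; _≢_; refl; sym; trans; cong; cong₂; subst; subst₂)
open import Relation.Nullary using (¬_; does; contradiction)
open import Relation.Nullary.Decidable using (_×-dec_)
open import Relation.Unary using (Decidable)

-- Finite sums

sum : ℕ → (ℕ → ℕ) → ℕ
sum zero    f = 0
sum (suc n) f = sum n f + f n

sum-cong : ∀ n {f g : ℕ → ℕ} → (∀ {i} → i < n → f i ≡ g i) → sum n f ≡ sum n g
sum-cong zero    f≡g = refl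
sum-cong (suc n) f≡g = cong₂ _+_ (sum-cong n (λ i<n → f≡g (m<n⇒m<1+n i<n))) (f≡g ≤-refl)

sum-mono : ∀ n {f g : ℕ → ℕ} → (∀ i → f i ≤ g i) → sum n f ≤ sum n g
sum-mono zero    f≤g = z≤n
sum-mono (suc n) f≤g = +-mono-≤ (sum-mono n f≤g) (f≤g n)

sum-+ : ∀ n (f g : ℕ → ℕ) → sum n (λ i → f i + g i) ≡ sum n f + sum n g
sum-+ zero    f g = refl
sum-+ (suc n) f g = trans (cong (_+ (f n + g n)) (sum-+ n f g)) (swap (sum n f) (sum n g) (f n) (g n))
  where
  swap : ∀ a b c d → (a + b) + (c + d) ≡ (a + c) + (b + d)
  swap = solve-∀

sum-cons : ∀ n (f : ℕ → ℕ) → sum (suc n) f ≡ f 0 + sum n (λ i → f (suc i))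
sum-cons zero    f = sym (+-identityʳ (f 0))
sum-cons (suc n) f = trans (cong (_+ f (suc n)) (sum-cons n f)) (+-assoc (f 0) _ _)

-- Both sides collect `f` below `m` and `g` up to `m`. The lemma regroups steps between columns from
-- the odd vertex they reach to the even vertex they leave.
sum-stagger : ∀ m (f g : ℕ → ℕ) →
  sum m (λ j → f j + g (suc j)) + g 0 ≡ sum m (λ j → f j + g j) + g m
sum-stagger zero    f g = refl
sum-stagger (suc m) f g =
  trans (lemma₁ (sum m (λ j → f j + g (suc j))) (f m) (g (suc m)) (g 0))
 (trans (cong (_+ (f m + g (suc m))) (sum-stagger m f g))
        (lemma₂ (sum m (λ j → f j + g j)) (g m) (f m) (g (suc m))))
  where
  lemma₁ : ∀ s a b c → s + (a + b) + c ≡ s + c + (a + b)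
  lemma₁ = solve-∀
  lemma₂ : ∀ s a b c → s + a + (b + c) ≡ s + (b + a) + c
  lemma₂ = solve-∀

-- Pairs of disjoint matchings

-- The even vertex (i , j), 0 ≤ j ≤ i ≤ n, has odd neighbours below, left, right and above, with
-- odd coordinates (i , j + 1), (i , j), (i + 1 , j + 1) and (i + 1 , j). D₁, L₁, R₁, U₁ are the
-- indicators of its arcs from them, D₂, L₂, R₂, U₂ those of its arcs to them. The bottom vertex
-- (i , i) has no neighbour below; D₁ i i and D₂ i i make up for its missing arc.
-- z i j indicates a red path crossing from column i to column i + 1 at the odd vertex (i + 1 , j + 1).
record MatchingPair (n : ℕ) (u v w : ℕ → ℕ) : Set where
  field
    D₁ L₁ R₁ U₁ D₂ L₂ R₂ U₂ z : ℕ → ℕ → ℕ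
    even₁    : ∀ {i j} → i ≤ n → j ≤ i → D₁ i j + (L₁ i j + R₁ i j + U₁ i j) ≡ 1
    even₂    : ∀ {i j} → i ≤ n → j ≤ i → D₂ i j + (L₂ i j + R₂ i j + U₂ i j) ≡ 1
    odd₁     : ∀ {i j} → suc i ≤ n → j ≤ i →
               D₁ (suc i) j + L₁ (suc i) (suc j) + (R₁ i j + U₁ i (suc j)) ≡ 1
    odd₂     : ∀ {i j} → suc i ≤ n → j ≤ i → D₂ (suc i) j + L₂ (suc i) (suc j) ≡ z i j
    z-law    : ∀ {i j} → i ≤ n → j ≤ i → z i j + (R₂ i j + U₂ i (suc j)) ≡ 1
    left₁-0  : L₁ 0 0 ≡ u 0
    left₁    : ∀ {i} → suc i ≤ n → L₁ (suc i) 0 + U₁ i 0 ≡ u (suc i)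
    left₂    : ∀ {i} → i ≤ n → L₂ i 0 + U₂ i 0 ≡ 0
    right₁   : ∀ {j} → j ≤ n → R₁ n j + U₁ n j ≡ 0
    right₂   : ∀ {j} → j ≤ n → z n j ≡ v j
    outside₁ : ∀ {i} → i ≤ n → U₁ i (suc i) ≡ 0
    outside₂ : ∀ {i} → i ≤ n → U₂ i (suc i) ≡ 0
    bottom₁  : ∀ {i} → i ≤ n → D₁ i i + w i ≡ 1
    bottom₂  : ∀ {i} → i ≤ n → D₂ i i ≡ w i
    disjoint : ∀ {i j} → i ≤ n → j ≤ i → D₁ i j + D₂ i j ≤ 1

module _ {n : ℕ} {u v w : ℕ → ℕ} (M : MatchingPair n u v w) where
  open MatchingPair M

  -- Flow of the blue paths

  inflow : ℕ → ℕ → ℕ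
  inflow i m = sum m (λ j → R₁ i j + U₁ i (suc j))

  -- The number of blue paths crossing from column i to column i + 1.
  S : ℕ → ℕ
  S i = sum (suc i) (λ j → R₁ i j + U₁ i j)

  -- Conservation of blue flow through the first `j + 1` even vertices of a column: what leaves them
  -- is what starts at the left boundary vertex, `1 - u (suc i)`, plus what enters from the previous
  -- column. The term `u` is moved to the left to avoid subtraction.
  column₁ : ∀ {i} j → suc i ≤ n → j ≤ suc i →
    sum (suc j) (λ b → R₁ (suc i) b + U₁ (suc i) b) + D₁ (suc i) j + u (suc i)
      ≡ suc (inflow i j + U₁ i 0)
  column₁ {i} zero i<n _ =
    trans (cong (λ t → R₁ (suc i) 0 + U₁ (suc i) 0 + D₁ (suc i) 0 + t) (sym (left₁ i<n)))
   (trans (arith (R₁ (suc i) 0) (U₁ (suc i) 0) (D₁ (suc i) 0) (L₁ (suc i) 0) (U₁ i 0))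
          (cong (_+ U₁ i 0) (even₁ i<n z≤n)))
    where
    arith : ∀ r u d l t → r + u + d + (l + t) ≡ d + (l + r + u) + t
    arith = solve-∀
  column₁ {i} (suc j) i<n (s≤s j≤i) =
    +-cancelʳ-≡ (D₁ (suc i) j + L₁ (suc i) (suc j)) _ _
   (trans (arith₁ (sum (suc j) (λ b → R₁ (suc i) b + U₁ (suc i) b)) (R₁ (suc i) (suc j))
                  (U₁ (suc i) (suc j)) (D₁ (suc i) (suc j)) (u (suc i))
                  (D₁ (suc i) j) (L₁ (suc i) (suc j)))
   (trans (cong₂ _+_ (even₁ i<n (s≤s j≤i)) (column₁ j i<n (m≤n⇒m≤1+n j≤i)))
   (trans (cong (_+ suc (inflow i j + U₁ i 0)) (sym (odd₁ i<n j≤i)))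
          (arith₂ (D₁ (suc i) j) (L₁ (suc i) (suc j)) (R₁ i j + U₁ i (suc j)) (inflow i j) (U₁ i 0)))))
    where
    arith₁ : ∀ s r u d t d′ l →
      s + (r + u) + d + t + (d′ + l) ≡ d + (l + r + u) + (s + d′ + t)
    arith₁ = solve-∀
    arith₂ : ∀ d l x s t → d + l + x + suc (s + t) ≡ suc (s + x + t) + (d + l)
    arith₂ = solve-∀

  -- Over a whole column, a blue path is gained if `u (suc i)` is 0 and lost at the bottom vertex if
  -- `w (suc i)` is 0.
  S-step : ∀ {i} → suc i ≤ n → S (suc i) + u (suc i) ≡ w (suc i) + S i
  S-step {i} i<n = +-cancelʳ-≡ (D₁ (suc i) (suc i)) _ _
    (trans (arith₁ (S (suc i)) (u (suc i)) (D₁ (suc i) (suc i)))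
    (trans (column₁ (suc i) i<n ≤-refl)
    (trans (cong suc (trans (sum-stagger (suc i) (R₁ i) (U₁ i))
                     (trans (cong (S i +_) (outside₁ (<⇒≤ i<n))) (+-identityʳ (S i)))))
    (trans (cong (_+ S i) (sym (bottom₁ i<n))) (arith₂ (D₁ (suc i) (suc i)) (w (suc i)) (S i))))))
    where
    arith₁ : ∀ s u d → s + u + d ≡ s + d + u
    arith₁ = solve-∀
    arith₂ : ∀ d w s → d + w + s ≡ w + s + d
    arith₂ = solve-∀

  -- The crossing paths are those started and not yet ended, so `S i` is a difference of numbers of
  -- 0s in prefixes of `u` and `w`, hence of numbers of 1s.
  cut₁ : ∀ {i} → i ≤ n → sum (suc i) u + S i ≡ sum (suc i) w
  cut₁ {zero} _ = +-cancelʳ-≡ (D₁ 0 0) _ _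
    (trans (cong (λ t → t + (R₁ 0 0 + U₁ 0 0) + D₁ 0 0) (sym left₁-0))
    (trans (arith (L₁ 0 0) (R₁ 0 0) (U₁ 0 0) (D₁ 0 0))
    (trans (even₁ z≤n z≤n) (trans (sym (bottom₁ z≤n)) (+-comm (D₁ 0 0) (w 0))))))
    where
    arith : ∀ l r u d → l + (r + u) + d ≡ d + (l + r + u)
    arith = solve-∀
  cut₁ {suc i} i<n =
    trans (arith₁ (sum (suc i) u) (u (suc i)) (S (suc i)))
   (trans (cong (sum (suc i) u +_) (S-step i<n))
   (trans (arith₂ (sum (suc i) u) (w (suc i)) (S i))
          (cong (_+ w (suc i)) (cut₁ (<⇒≤ i<n)))))
    where
    arith₁ : ∀ s u t → s + u + t ≡ s + (t + u)
    arith₁ = solve-∀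
    arith₂ : ∀ s w t → s + (w + t) ≡ s + t + w
    arith₂ = solve-∀

  sum-right₁ : ∀ m → m ≤ suc n → sum m (λ j → R₁ n j + U₁ n j) ≡ 0
  sum-right₁ zero    _         = refl
  sum-right₁ (suc m) (s≤s m≤n) = cong₂ _+_ (sum-right₁ m (m≤n⇒m≤1+n m≤n)) (right₁ m≤n)

  u-total : sum (suc n) u ≡ sum (suc n) w
  u-total = trans (sym (+-identityʳ _))
           (trans (cong (sum (suc n) u +_) (sym (sum-right₁ (suc n) ≤-refl))) (cut₁ ≤-refl))

  u≤w : ∀ m → m ≤ suc n → sum m u ≤ sum m w
  u≤w zero    _         = z≤n
  u≤w (suc m) (s≤s m≤n) = subst (sum (suc m) u ≤_) (cut₁ m≤n) (m≤m+n _ (S m))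

  u-area : sum (suc n) (λ i → sum (suc i) u) + sum (suc n) S ≡ sum (suc n) (λ i → sum (suc i) w)
  u-area = trans (sym (sum-+ (suc n) _ S)) (sum-cong (suc n) (λ { (s≤s i≤n) → cut₁ i≤n }))

  -- Flow of the red paths

  Z : ℕ → ℕ → ℕ
  Z i m = sum m (z i)

  -- The steps by which a red path moves down towards smaller j.
  C : ℕ → ℕ → ℕ
  C i j = L₂ i j + U₂ i j

  -- A red path reaches the even vertex `(i , j)` from the next column or by an up step within the
  -- column; it leaves by `D₂` or by a step counted in `C`.
  z-C : ∀ {i j} → i ≤ n → j ≤ i → z i j + U₂ i (suc j) ≡ D₂ i j + C i j
  z-C {i} {j} i≤n j≤i = +-cancelʳ-≡ (R₂ i j) _ _
    (trans (arith₁ (z i j) (U₂ i (suc j)) (R₂ i j))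
    (trans (trans (z-law i≤n j≤i) (sym (even₂ i≤n j≤i)))
           (arith₂ (D₂ i j) (L₂ i j) (R₂ i j) (U₂ i j))))
    where
    arith₁ : ∀ z u r → z + u + r ≡ z + (r + u)
    arith₁ = solve-∀
    arith₂ : ∀ d l r u → d + (l + r + u) ≡ d + (l + u) + r
    arith₂ = solve-∀

  -- A red path keeps its index on a down step and lowers it by one on a step of `C`. So the paths
  -- below `m` are joined exactly by those dropping from `m` in column `suc i`. Nothing drops below
  -- 0, as no arc enters a left boundary vertex.
  Z-step : ∀ {i} m → suc i ≤ n → m ≤ suc i → Z i m ≡ Z (suc i) m + C (suc i) m
  Z-step zero    i<n _         = sym (left₂ i<n)
  Z-step {i} (suc m) i<n (s≤s m≤i) =
    trans (cong₂ _+_ (Z-step m i<n (m≤n⇒m≤1+n m≤i)) (sym (odd₂ i<n m≤i)))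
   (trans (arith₁ (Z (suc i) m) (C (suc i) m) (D₂ (suc i) m) (L₂ (suc i) (suc m)))
   (trans (cong (λ t → Z (suc i) m + t + L₂ (suc i) (suc m)) (sym (z-C i<n (m≤n⇒m≤1+n m≤i))))
          (arith₂ (Z (suc i) m) (z (suc i) m) (U₂ (suc i) (suc m)) (L₂ (suc i) (suc m)))))
    where
    arith₁ : ∀ a c d l → a + c + (d + l) ≡ a + (d + c) + l
    arith₁ = solve-∀
    arith₂ : ∀ a z u l → a + (z + u) + l ≡ a + z + (l + u)
    arith₂ = solve-∀

  z-diagonal : ∀ {i} → i ≤ n → z i i ≡ w i + C i i
  z-diagonal {i} i≤n =
    trans (sym (trans (cong (z i i +_) (outside₂ i≤n)) (+-identityʳ (z i i))))
   (trans (z-C i≤n ≤-refl) (cong (_+ C i i) (bottom₂ i≤n)))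

  -- Every red path crossing into column `i` ends at a bottom vertex of one of the columns 0 to `i`.
  Z-diagonal : ∀ {i} → i ≤ n → Z i (suc i) ≡ sum (suc i) w
  Z-diagonal {zero}  i≤n = trans (z-diagonal i≤n)
                          (trans (cong (w 0 +_) (left₂ i≤n)) (+-identityʳ (w 0)))
  Z-diagonal {suc i} i<n =
    trans (cong (Z (suc i) (suc i) +_) (z-diagonal i<n))
   (trans (arith (Z (suc i) (suc i)) (w (suc i)) (C (suc i) (suc i)))
   (trans (cong (_+ w (suc i)) (sym (Z-step (suc i) i<n ≤-refl)))
          (cong (_+ w (suc i)) (Z-diagonal (<⇒≤ i<n)))))
    where
    arith : ∀ a w c → a + (w + c) ≡ a + c + w
    arith = solve-∀

  Z-last : ∀ m → m ≤ suc n → Z n m ≡ sum m v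
  Z-last m m≤ = sum-cong m (λ j<m → right₂ (≤-pred (≤-trans j<m m≤)))

  v-total : sum (suc n) v ≡ sum (suc n) w
  v-total = trans (sym (Z-last (suc n) ≤-refl)) (Z-diagonal ≤-refl)

  -- For a fixed cut, `Z` can only grow as the column decreases, until the cut reaches the diagonal
  -- and the count is exact.
  Z≤w : ∀ {i} m → i ≤ n → m ≤ i → Z i (suc m) ≤ sum (suc m) w
  Z≤w {zero} .zero i≤n z≤n = ≤-reflexive (Z-diagonal i≤n)
  Z≤w {suc i} m i<n m≤1+i with m≤n⇒m<n∨m≡n m≤1+i
  ... | inj₂ refl      = ≤-reflexive (Z-diagonal i<n)
  ... | inj₁ (s≤s m≤i) = ≤-trans
    (subst (Z (suc i) (suc m) ≤_) (sym (Z-step (suc m) i<n (s≤s m≤i))) (m≤m+n _ _))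
    (Z≤w m (<⇒≤ i<n) m≤i)

  v≤w : ∀ m → m ≤ suc n → sum m v ≤ sum m w
  v≤w zero    _         = z≤n
  v≤w (suc m) (s≤s m≤n) = subst (_≤ sum (suc m) w) (Z-last (suc m) (s≤s m≤n)) (Z≤w m ≤-refl m≤n)

  Q : ℕ → ℕ
  Q i = sum (suc i) (C i)

  -- Summing `Z-step` over all cuts collects its increments into `Q`; the extra cut on the diagonal
  -- supplies the next prefix sum of `w`.
  Z-area : ∀ {i} → i ≤ n →
    sum (suc i) (λ m → Z i (suc m)) + sum (suc i) Q ≡ sum (suc i) (λ m → sum (suc m) w)
  Z-area {zero} i≤n =
    trans (cong₂ _+_ (Z-diagonal i≤n) (left₂ i≤n)) (+-identityʳ (w 0))
  Z-area {suc i} i<n =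
    trans (cong (sum (suc i) (λ m → Z (suc i) (suc m)) + Z (suc i) (suc (suc i)) +_)
            (cong (sum (suc i) Q +_)
              (trans (sum-cons (suc i) (C (suc i))) (cong (_+ sum (suc i) (λ m → C (suc i) (suc m))) (left₂ i<n)))))
   (trans (arith (sum (suc i) (λ m → Z (suc i) (suc m))) (Z (suc i) (suc (suc i)))
                 (sum (suc i) Q) (sum (suc i) (λ m → C (suc i) (suc m))))
   (trans (cong (λ t → t + sum (suc i) Q + Z (suc i) (suc (suc i)))
            (trans (sym (sum-+ (suc i) _ _)) (sum-cong (suc i) (λ {m} m≤i → sym (Z-step (suc m) i<n m≤i)))))
          (cong₂ _+_ (Z-area (<⇒≤ i<n)) (Z-diagonal i<n))))
    where
    arith : ∀ a b q c → a + b + (q + c) ≡ a + c + q + b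
    arith = solve-∀

  v-area : sum (suc n) (λ i → sum (suc i) v) + sum (suc n) Q ≡ sum (suc n) (λ i → sum (suc i) w)
  v-area = trans (cong (_+ sum (suc n) Q) (sum-cong (suc n) (λ {m} m≤n → sym (Z-last (suc m) m≤n))))
                 (Z-area ≤-refl)

  -- Crossings of blue and red paths

  -- Pairs of a blue and a red path crossing from column i to column i + 1, red not above blue.
  Ξ : ℕ → ℕ → ℕ
  Ξ i m = sum m (λ j → (R₁ i j + U₁ i (suc j)) * Z i (suc j))

  -- The steps that pay for crossings: blue right steps and red left or up steps.
  X : ℕ → ℕ → ℕ
  X i m = sum m (λ j → R₁ i j + C i j)

  -- A blue path going straight through (i , j) meets a red path there only if the latter does not
  -- use the same edge: this is where disjointness of the two matchings enters.
  D₁z≤C : ∀ {i j} → i ≤ n → j ≤ i → D₁ i j * z i j ≤ C i j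
  D₁z≤C {i} {j} i≤n j≤i with D₁ i j | D₂ i j | z i j | disjoint i≤n j≤i | z-C i≤n j≤i
  ... | 0           | _ | _ | _      | _  = z≤n
  ... | 1           | 0 | ζ | _      | eq = subst (ζ + 0 ≤_) eq (+-monoʳ-≤ ζ z≤n)
  ... | 1           | suc _ | _ | s≤s () | _
  ... | suc (suc _) | _ | _ | s≤s () | _

  R₁z≤R₁ : ∀ {i j} → i ≤ n → j ≤ i → R₁ i j * z i j ≤ R₁ i j
  R₁z≤R₁ {i} {j} i≤n j≤i = subst (R₁ i j * z i j ≤_) (*-identityʳ (R₁ i j))
    (*-monoʳ-≤ (R₁ i j) (subst (z i j ≤_) (z-law i≤n j≤i) (m≤m+n _ _)))

  -- A blue path arrives at `(i , j)` paired with the red crossings of index below `j`. An up step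
  -- keeps these pairs; a down or right step adds the red crossing of index `j`, if any. A right
  -- step pays for it itself, and for a down step `C` pays.
  vertex-bound : ∀ {i j} → i ≤ n → j ≤ i →
    (D₁ i j + R₁ i j) * Z i (suc j) + U₁ i j * Z i j
      ≤ (D₁ i j + R₁ i j + U₁ i j) * Z i j + (R₁ i j + C i j)
  vertex-bound {i} {j} i≤n j≤i =
    subst₂ _≤_ (arith₁ (D₁ i j) (R₁ i j) (U₁ i j) (Z i j) (z i j)) refl
      (+-monoʳ-≤ ((D₁ i j + R₁ i j + U₁ i j) * Z i j) (+-mono-≤ (R₁z≤R₁ i≤n j≤i) (D₁z≤C i≤n j≤i)))
    where
    arith₁ : ∀ d r u Z z → (d + r + u) * Z + (r * z + d * z) ≡ (d + r) * (Z + z) + u * Z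
    arith₁ = solve-∀

  -- A blue path comes to an even vertex through the odd vertex on its left; both sides equal
  -- `1 - L₁ (suc i) (suc j)`.
  outflow₁ : ∀ {i j} → suc i ≤ n → j ≤ i →
    D₁ (suc i) (suc j) + R₁ (suc i) (suc j) + U₁ (suc i) (suc j)
      ≡ D₁ (suc i) j + (R₁ i j + U₁ i (suc j))
  outflow₁ {i} {j} i<n j≤i = +-cancelʳ-≡ (L₁ (suc i) (suc j)) _ _
    (trans (arith₁ (D₁ (suc i) (suc j)) (R₁ (suc i) (suc j)) (U₁ (suc i) (suc j)) (L₁ (suc i) (suc j)))
    (trans (trans (even₁ i<n (s≤s j≤i)) (sym (odd₁ i<n j≤i)))
           (arith₂ (D₁ (suc i) j) (L₁ (suc i) (suc j)) (R₁ i j + U₁ i (suc j)))))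
    where
    arith₁ : ∀ d r u l → d + r + u + l ≡ d + (l + r + u)
    arith₁ = solve-∀
    arith₂ : ∀ d l s → d + l + s ≡ d + s + l
    arith₂ = solve-∀

  -- `Ξ` serves as a potential, whose growth along a column is paid for by `X`. The first summand
  -- carries the blue path leaving vertex `j` down or right, which `Ξ (suc i) j` does not yet
  -- include.
  column-bound : ∀ {i} j → suc i ≤ n → j ≤ suc i →
    (D₁ (suc i) j + R₁ (suc i) j) * Z (suc i) (suc j) + Ξ (suc i) j ≤ Ξ i j + X (suc i) (suc j)
  column-bound {i} zero i<n _ = subst₂ _≤_
    (arith₁ (D₁ (suc i) 0 + R₁ (suc i) 0) (Z (suc i) 1) (U₁ (suc i) 0))
    (arith₂ (D₁ (suc i) 0 + R₁ (suc i) 0 + U₁ (suc i) 0) (R₁ (suc i) 0 + C (suc i) 0))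
    (vertex-bound i<n z≤n)
    where
    arith₁ : ∀ a z u → a * z + u * 0 ≡ a * z + 0
    arith₁ = solve-∀
    arith₂ : ∀ a x → a * 0 + x ≡ x
    arith₂ = solve-∀
  column-bound {i} (suc j) i<n (s≤s j≤i) = begin
    (δ + r) * Z (suc i) (suc (suc j)) + (Ξ (suc i) j + (r′ + u′) * ζ)
      ≡⟨ arith₁ ((δ + r) * Z (suc i) (suc (suc j))) (Ξ (suc i) j) r′ u′ ζ ⟩
    (δ + r) * Z (suc i) (suc (suc j)) + u′ * ζ + (Ξ (suc i) j + r′ * ζ)
      ≤⟨ +-monoˡ-≤ _ (vertex-bound i<n (s≤s j≤i)) ⟩
    (δ + r + u′) * ζ + x + (Ξ (suc i) j + r′ * ζ)
      ≡⟨ cong (λ t → t * ζ + x + (Ξ (suc i) j + r′ * ζ)) (outflow₁ i<n j≤i) ⟩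
    (δ′ + s) * ζ + x + (Ξ (suc i) j + r′ * ζ)
      ≡⟨ arith₂ δ′ s ζ x (Ξ (suc i) j) r′ ⟩
    ((δ′ + r′) * ζ + Ξ (suc i) j) + (s * ζ + x)
      -- A blue path from the previous column was paired there with at least as many red crossings,
      -- since red indices never rise on the way left.
      ≤⟨ +-mono-≤ (column-bound j i<n (m≤n⇒m≤1+n j≤i)) (+-monoˡ-≤ x (*-monoʳ-≤ s Z-mono)) ⟩
    (Ξ i j + X (suc i) (suc j)) + (s * Z i (suc j) + x)
      ≡⟨ arith₃ (Ξ i j) (X (suc i) (suc j)) (s * Z i (suc j)) x ⟩
    Ξ i (suc j) + X (suc i) (suc (suc j)) ∎
    where
    open ≤-Reasoning
    δ = D₁ (suc i) (suc j)
    r = R₁ (suc i) (suc j)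
    u′ = U₁ (suc i) (suc j)
    δ′ = D₁ (suc i) j
    r′ = R₁ (suc i) j
    ζ = Z (suc i) (suc j)
    s = R₁ i j + U₁ i (suc j)
    x = R₁ (suc i) (suc j) + C (suc i) (suc j)
    Z-mono : Z (suc i) (suc j) ≤ Z i (suc j)
    Z-mono = subst (ζ ≤_) (sym (Z-step (suc j) i<n (s≤s j≤i))) (m≤m+n _ _)
    arith₁ : ∀ a X r u z → a + (X + (r + u) * z) ≡ a + u * z + (X + r * z)
    arith₁ = solve-∀
    arith₂ : ∀ d s z x X r → (d + s) * z + x + (X + r * z) ≡ (d + r) * z + X + (s * z + x)
    arith₂ = solve-∀
    arith₃ : ∀ a b c d → (a + b) + (c + d) ≡ (a + c) + (b + d)
    arith₃ = solve-∀

  -- The substitute down step at the bottom ends a blue path and makes its pairs final: they are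
  -- formed with the red paths ending in columns 0 to `i`.
  crossing-diagonal : ∀ {i} → i ≤ n → (D₁ i i + R₁ i i) * Z i (suc i) + Ξ i i ≡
    D₁ i i * sum (suc i) w + Ξ i (suc i)
  crossing-diagonal {i} i≤n =
    trans (arith₁ (D₁ i i) (R₁ i i) (Z i (suc i)) (Ξ i i))
          (cong₂ (λ p u → D₁ i i * p + (Ξ i i + (R₁ i i + u) * Z i (suc i)))
            (Z-diagonal i≤n) (sym (outside₁ i≤n)))
    where
    arith₁ : ∀ d r z X → (d + r) * z + X ≡ d * z + (X + (r + 0) * z)
    arith₁ = solve-∀

  -- The column bounds telescope in `Ξ`. The final pairs of the ended blue paths remain, and these
  -- are inversions of `w`.
  crossing-bound : ∀ {i} → i ≤ n →
    sum (suc i) (λ k → D₁ k k * sum (suc k) w) + Ξ i (suc i) ≤ sum (suc i) (λ k → X k (suc k))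
  crossing-bound {zero} i≤n = subst₂ _≤_
    (trans (arith₁ ((D₁ 0 0 + R₁ 0 0) * Z 0 1) (U₁ 0 0)) (crossing-diagonal z≤n))
    (arith₂ (D₁ 0 0 + R₁ 0 0 + U₁ 0 0) (R₁ 0 0 + C 0 0))
    (vertex-bound z≤n z≤n)
    where
    arith₁ : ∀ a u → a + u * 0 ≡ a + 0
    arith₁ = solve-∀
    arith₂ : ∀ a x → a * 0 + x ≡ x
    arith₂ = solve-∀
  crossing-bound {suc i} i<n = +-cancelʳ-≤ (Ξ i (suc i)) _ _ (subst₂ _≤_
    (trans (cong (total i + Ξ i (suc i) +_) (crossing-diagonal i<n))
           (arith₁ (total i) (Ξ i (suc i)) (D₁ (suc i) (suc i) * sum (suc (suc i)) w) (Ξ (suc i) (suc (suc i)))))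
    (arith₂ (sum (suc i) (λ k → X k (suc k))) (Ξ i (suc i)) (X (suc i) (suc (suc i))))
    (+-mono-≤ (crossing-bound (<⇒≤ i<n)) (column-bound (suc i) i<n ≤-refl)))
    where
    total : ℕ → ℕ
    total i = sum (suc i) (λ k → D₁ k k * sum (suc k) w)
    arith₁ : ∀ t x a y → t + x + (a + y) ≡ t + a + y + x
    arith₁ = solve-∀
    arith₂ : ∀ s x y → s + (x + y) ≡ s + y + x
    arith₂ = solve-∀

  w-bound : sum (suc n) (λ k → D₁ k k * sum (suc k) w) ≤ sum (suc n) S + sum (suc n) Q
  w-bound = begin
    sum (suc n) (λ k → D₁ k k * sum (suc k) w)                ≤⟨ m≤m+n _ _ ⟩
    sum (suc n) (λ k → D₁ k k * sum (suc k) w) + Ξ n (suc n)  ≤⟨ crossing-bound ≤-refl ⟩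
    sum (suc n) (λ k → X k (suc k))
      -- Adding the blue up steps completes the blue part to `S`.
      ≤⟨ sum-mono (suc n) (λ k → sum-mono (suc k) (λ j → +-monoˡ-≤ (C k j) (m≤m+n (R₁ k j) (U₁ k j)))) ⟩
    sum (suc n) (λ k → sum (suc k) (λ j → R₁ k j + U₁ k j + C k j))
      ≡⟨ sum-cong (suc n) (λ {k} _ → sum-+ (suc k) _ (C k)) ⟩
    sum (suc n) (λ k → S k + Q k)                             ≡⟨ sum-+ (suc n) S Q ⟩
    sum (suc n) S + sum (suc n) Q                             ∎
    where open ≤-Reasoning

-- Words

-- The extension by 0 makes a word a total sequence, so that its prefix counts are values of `sum`.
bit : ∀ {N} → Word N → ℕ → ℕ
bit []      _       = 0
bit (x ∷ u) zero    = toℕ x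
bit (x ∷ u) (suc i) = bit u i

bit-lookup : ∀ {N} (u : Word N) i → bit u (toℕ i) ≡ toℕ (lookup u i)
bit-lookup (x ∷ u) zero    = refl
bit-lookup (x ∷ u) (suc i) = bit-lookup u i

ones-∷ : ∀ {N} x (u : Word N) → ∣ x ∷ u ∣₁ ≡ toℕ x + ∣ u ∣₁
ones-∷ zero       u = refl
ones-∷ (suc zero) u = refl

ones-truncate : ∀ {N m} (m≤N : m ≤ N) (u : Word N) → ∣ truncate m≤N u ∣₁ ≡ sum m (bit u)
ones-truncate z≤n       u       = refl
ones-truncate {m = suc m} (s≤s m≤N) (x ∷ u) = trans (ones-∷ x (truncate m≤N u))
  (trans (cong (toℕ x +_) (ones-truncate m≤N u)) (sym (sum-cons m (bit (x ∷ u)))))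

ones : ∀ {N} (u : Word N) → ∣ u ∣₁ ≡ sum N (bit u)
ones []      = refl
ones {suc N} (x ∷ u) = trans (ones-∷ x u) (trans (cong (toℕ x +_) (ones u)) (sym (sum-cons N (bit (x ∷ u)))))

zeros+ones : ∀ {N} (u : Word N) → ∣ u ∣₀ + ∣ u ∣₁ ≡ N
zeros+ones []               = refl
zeros+ones (zero ∷ u)       = cong suc (zeros+ones u)
zeros+ones (suc zero ∷ u)   = trans (+-suc ∣ u ∣₀ ∣ u ∣₁) (cong suc (zeros+ones u))

-- Recursive counting of inversions

card : ∀ {A : Set} {P : A → Set} → Decidable P → List A → ℕ
card P? xs = length (filter P? xs)

private variable
  A A′ : Set

-- Comparing only the values of `does` allows inversions of a word and of its tail to be matched by
-- `refl`.
card-cong : {P Q : A → Set} (P? : Decidable P) (Q? : Decidable Q) →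
  (∀ x → does (P? x) ≡ does (Q? x)) → ∀ xs → card P? xs ≡ card Q? xs
card-cong P? Q? P≡Q []       = refl
card-cong P? Q? P≡Q (x ∷ xs) with does (P? x) | does (Q? x) | P≡Q x
... | true  | _ | refl = cong suc (card-cong P? Q? P≡Q xs)
... | false | _ | refl = card-cong P? Q? P≡Q xs

card-map : {P : A′ → Set} (P? : Decidable P) (f : A → A′) → ∀ xs →
  card P? (map f xs) ≡ card (λ x → P? (f x)) xs
card-map P? f []       = refl
card-map P? f (x ∷ xs) with does (P? (f x))
... | true  = cong suc (card-map P? f xs)
... | false = card-map P? f xs

card-++ : {P : A → Set} (P? : Decidable P) → ∀ xs ys → card P? (xs ++ ys) ≡ card P? xs + card P? ys
card-++ P? xs ys = trans (cong length (filter-++ P? xs ys)) (length-++ (filter P? xs))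

card-none : {P : A → Set} (P? : Decidable P) → (∀ x → does (P? x) ≡ false) → ∀ xs → card P? xs ≡ 0
card-none P? P≡ []       = refl
card-none P? P≡ (x ∷ xs) with does (P? x) | P≡ x
... | _ | refl = card-none P? P≡ xs

allFin-suc : ∀ n → allFin (suc n) ≡ zero ∷ map suc (allFin n)
allFin-suc n = cong (zero ∷_) (sym (map-tabulate (λ i → i) suc))

card-cartesianProduct-map : ∀ {P : A × A → Set} {Q : A′ × A′ → Set} (P? : Decidable P) (Q? : Decidable Q)
  (f : A′ → A) y₀ → (∀ x → does (P? (f x , y₀)) ≡ false) →
  (∀ x y → does (P? (f x , f y)) ≡ does (Q? (x , y))) → ∀ xs ys →
  card P? (cartesianProduct (map f xs) (y₀ ∷ map f ys)) ≡ card Q? (cartesianProduct xs ys)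
card-cartesianProduct-map P? Q? f y₀ Py₀ P≡Q []       ys = refl
card-cartesianProduct-map P? Q? f y₀ Py₀ P≡Q (x ∷ xs) ys =
  trans (card-++ P? (map (f x ,_) (y₀ ∷ map f ys)) (cartesianProduct (map f xs) (y₀ ∷ map f ys)))
 (trans (cong₂ _+_ row (card-cartesianProduct-map P? Q? f y₀ Py₀ P≡Q xs ys))
        (sym (card-++ Q? (map (x ,_) ys) (cartesianProduct xs ys))))
  where
  row : card P? (map (f x ,_) (y₀ ∷ map f ys)) ≡ card Q? (map (x ,_) ys)
  row with does (P? (f x , y₀)) | Py₀ x
  ... | _ | refl = trans (card-map P? (f x ,_) (map f ys))
                  (trans (card-map (λ y → P? (f x , y)) f ys)
                  (trans (card-cong _ (λ y → Q? (x , y)) (P≡Q x) ys) (sym (card-map Q? (x ,_) ys))))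

card-zeros : ∀ {N} (u : Word N) → card (λ i → lookup u i Fin.≟ 0b) (allFin N) ≡ ∣ u ∣₀
card-zeros []          = refl
card-zeros {suc N} (x ∷ u) = trans (cong (card (λ i → lookup (x ∷ u) i Fin.≟ 0b)) (allFin-suc N)) (head x)
  where
  tail : ∀ x → card (λ i → lookup (x ∷ u) i Fin.≟ 0b) (map suc (allFin N)) ≡ ∣ u ∣₀
  tail x = trans (card-map _ suc (allFin N)) (card-zeros u)
  head : ∀ x → card (λ i → lookup (x ∷ u) i Fin.≟ 0b) (zero ∷ map suc (allFin N)) ≡ ∣ x ∷ u ∣₀
  head zero       = cong suc (tail zero)
  head (suc zero) = tail (suc zero)

Inversion : ∀ {N} → Word N → Fin N × Fin N → Set
Inversion u (i , j) = i Fin.< j × lookup u i ≡ 1b × lookup u j ≡ 0b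

inversion? : ∀ {N} (u : Word N) → Decidable (Inversion u)
inversion? u (i , j) = (i Fin.<? j) ×-dec (lookup u i Fin.≟ 1b) ×-dec (lookup u j Fin.≟ 0b)

-- The first letter is never the later member of an inversion; as the earlier one, if it is 1, it
-- pairs with every 0 of `u`.
d-∷ : ∀ {N} x (u : Word N) → d (x ∷ u) ≡ toℕ x * ∣ u ∣₀ + d u
d-∷ {N} x u =
  trans (cong (λ is → card (inversion? (x ∷ u)) (cartesianProduct is is)) (allFin-suc N))
 (trans (card-++ (inversion? (x ∷ u)) (map (zero ,_) (zero ∷ map suc (allFin N)))
          (cartesianProduct (map suc (allFin N)) (zero ∷ map suc (allFin N))))
        (cong₂ _+_ (trans (card-map (inversion? (x ∷ u)) (zero ,_) (map suc (allFin N)))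
                   (trans (card-map (λ j → inversion? (x ∷ u) (zero , j)) suc (allFin N)) (head x)))
                   (card-cartesianProduct-map (inversion? (x ∷ u)) (inversion? u) suc zero
                     (λ _ → refl) (λ _ _ → refl) (allFin N) (allFin N))))
  where
  head : ∀ x → card (λ j → inversion? (x ∷ u) (zero , suc j)) (allFin N) ≡ toℕ x * ∣ u ∣₀
  head zero       = card-none _ (λ _ → refl) (allFin N)
  head (suc zero) = trans (card-cong _ (λ j → lookup u j Fin.≟ 0b) (λ _ → refl) (allFin N))
                   (trans (card-zeros u) (sym (*-identityˡ ∣ u ∣₀)))

-- Inversions and sums of prefix counts

triangular : ℕ → ℕ
triangular n = sum n suc

prefix-∷ : ∀ {N} x (u : Word N) i → sum (suc i) (bit (x ∷ u)) ≡ toℕ x + sum i (bit u)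
prefix-∷ x u i = sum-cons i (bit (x ∷ u))

sum-const-+ : ∀ n c f → sum n (λ i → c + f i) ≡ n * c + sum n f
sum-const-+ zero    c f = refl
sum-const-+ (suc n) c f = trans (cong (_+ (c + f n)) (sum-const-+ n c f)) (arith (n * c) (sum n f) c (f n))
  where
  arith : ∀ a s c x → a + s + (c + x) ≡ c + a + (s + x)
  arith = solve-∀

area : ∀ {N} → Word N → ℕ
area {N} u = sum N (λ i → sum (suc i) (bit u))

area-∷ : ∀ {N} x (u : Word N) → area (x ∷ u) ≡ suc N * toℕ x + area u
area-∷ {N} x u =
  trans (sum-cons N (λ i → sum (suc i) (bit (x ∷ u))))
 (trans (cong (toℕ x +_) (trans (sum-cong N (λ {i} _ → prefix-∷ x u (suc i))) (sum-const-+ N (toℕ x) _)))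
        (sym (+-assoc (toℕ x) (N * toℕ x) (area u))))

-- A 1 is counted by each prefix ending at or after it: once for itself and once for every later
-- letter. The later 0s give the inversions, the rest adds up to a triangular number.
area-d : ∀ {N} (u : Word N) → area u ≡ d u + triangular ∣ u ∣₁
area-d []      = refl
area-d {suc N} (zero ∷ u) =
  trans (area-∷ zero u)
 (trans (cong₂ _+_ (*-zeroʳ N) (area-d u)) (cong (_+ triangular ∣ u ∣₁) (sym (d-∷ zero u))))
area-d {suc N} (suc zero ∷ u) =
  trans (area-∷ 1b u)
 (trans (cong₂ _+_ (trans (*-identityʳ (suc N)) (cong suc (sym (zeros+ones u)))) (area-d u))
 (trans (arith ∣ u ∣₀ ∣ u ∣₁ (d u) (triangular ∣ u ∣₁))
        (cong (_+ triangular (suc ∣ u ∣₁)) (sym (d-∷ 1b u)))))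
  where
  arith : ∀ z o d t → suc (z + o) + (d + t) ≡ z + 0 + d + (t + suc o)
  arith = solve-∀

zero-count : ∀ {N} (u : Word N) → sum N (λ i → 1 ∸ bit u i) ≡ ∣ u ∣₀
zero-count []      = refl
zero-count {suc N} (zero ∷ u)     = trans (sum-cons N _) (cong suc (zero-count u))
zero-count {suc N} (suc zero ∷ u) = trans (sum-cons N _) (zero-count u)

-- Inversions are sorted by their 0, which can be included in the prefix without changing the number
-- of 1s.
d-prefix : ∀ {N} (u : Word N) → d u ≡ sum N (λ i → (1 ∸ bit u i) * sum (suc i) (bit u))
d-prefix []      = refl
d-prefix {suc N} (x ∷ u) =
  trans (d-∷ x u) (trans (head x) (sym (sum-cons N (λ i → (1 ∸ bit (x ∷ u) i) * sum (suc i) (bit (x ∷ u))))))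
  where
  f : ℕ → ℕ
  f i = (1 ∸ bit u i) * sum (suc i) (bit u)
  tail : ∀ x → sum N (λ i → (1 ∸ bit u i) * sum (suc (suc i)) (bit (x ∷ u))) ≡
    sum N (λ i → (1 ∸ bit u i) * toℕ x) + sum N f
  tail x = trans (sum-cong N (λ {i} _ → trans (cong ((1 ∸ bit u i) *_) (prefix-∷ x u (suc i)))
                                              (*-distribˡ-+ (1 ∸ bit u i) (toℕ x) _)))
                 (sum-+ N _ f)
  head : ∀ x → toℕ x * ∣ u ∣₀ + d u ≡
    (1 ∸ toℕ x) * toℕ x + sum N (λ i → (1 ∸ bit u i) * sum (suc (suc i)) (bit (x ∷ u)))
  head zero       = sym (trans (tail zero)
    (trans (cong (_+ sum N f) (sum-zero N)) (sym (d-prefix u))))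
    where
    sum-zero : ∀ m → sum m (λ i → (1 ∸ bit u i) * 0) ≡ 0
    sum-zero zero    = refl
    sum-zero (suc m) = cong₂ _+_ (sum-zero m) (*-zeroʳ (1 ∸ bit u m))
  head (suc zero) = trans (cong₂ _+_ (*-identityˡ ∣ u ∣₀) (d-prefix u))
    (sym (trans (tail 1b) (cong (_+ sum N f)
      (trans (sum-cong N (λ {i} _ → *-identityʳ (1 ∸ bit u i))) (zero-count u)))))

-- Coordinates of vertices

open import Data.Integer using (+_; -_)

ind : Bool → ℕ
ind false = 0
ind true  = 1

length-filterᵇ-∷ : ∀ {A : Set} (g : A → Bool) x xs →
  length (filterᵇ g (x ∷ xs)) ≡ ind (g x) + length (filterᵇ g xs)
length-filterᵇ-∷ g x xs with g x
... | true  = refl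
... | false = refl

length-filterᵇ₄ : ∀ {A : Set} (g : A → Bool) a b c d →
  length (filterᵇ g (a ∷ b ∷ c ∷ d ∷ [])) ≡ ind (g a) + (ind (g b) + (ind (g c) + ind (g d)))
length-filterᵇ₄ g a b c d =
  trans (length-filterᵇ-∷ g a _) (cong (_+_ (ind (g a)))
 (trans (length-filterᵇ-∷ g b _) (cong (_+_ (ind (g b)))
 (trans (length-filterᵇ-∷ g c _) (cong (_+_ (ind (g c)))
 (trans (length-filterᵇ-∷ g d _) (+-identityʳ (ind (g d)))))))))

InG⇒bounds : ∀ {N x y} → InG N (x , y) →
  (- (+ N) ℤ.≤ y) × (y ℤ.< + 0) × (y ℤ.≤ x) × (x ℤ.+ y ℤ.≤ + 0)
InG⇒bounds {x = x} (suc k , _ , k≤N , refl , -k≤x , x≤k) =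
  ℤ.neg-mono-≤ (ℤ.+≤+ k≤N) , ℤ.-<+ , -k≤x ,
  subst (x ℤ.+ - (+ suc k) ℤ.≤_) (ℤ.+-inverseʳ (+ suc k)) (ℤ.+-monoˡ-≤ (- (+ suc k)) x≤k)

≤-by : ∀ {i j} m → j ≡ i ℤ.+ + m → i ℤ.≤ j
≤-by {i} m refl = ℤ.i≤i+j i (+ m)

i≰pred-i : ∀ i → ¬ i ℤ.≤ ℤ.pred i
i≰pred-i i i≤ = ℤ.<-irrefl refl (ℤ.i≤pred[j]⇒i<j i≤)

suc-i≰i : ∀ i → ¬ ℤ.suc i ℤ.≤ i
suc-i≰i i i≤ = ℤ.<-irrefl refl (ℤ.suc[i]≤j⇒i<j i≤)

-- The even and odd vertices, sorted by the diagonals through them: x + y determines i and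
-- x - y determines j.
even odd : ℕ → ℕ → ℕ → Point
even n i j = + suc (i + j) ℤ.- + suc n , + i ℤ.- + j ℤ.- + suc n
odd  n i j = + (i + j)     ℤ.- + suc n , + i ℤ.- + j ℤ.- + suc n

neighbours-even : ∀ n i j → neighbours (even n i j) ≡
  odd n (suc i) (suc j) ∷ odd n i j ∷ odd n (suc i) j ∷ odd n i (suc j) ∷ []
neighbours-even n i j =
  cong₂ _∷_ (cong₂ _,_ (right (+ i) (+ j) (+ suc n)) (keep (+ i) (+ j) (+ suc n)))
 (cong₂ _∷_ (cong₂ _,_ (left (+ i) (+ j) (+ suc n)) refl)
 (cong₂ _∷_ (cong₂ _,_ refl (up (+ i) (+ j) (+ suc n)))
 (cong₂ _∷_ (cong₂ _,_ (flat (+ i) (+ j) (+ suc n)) (down (+ i) (+ j) (+ suc n))) refl)))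
  where
  right : ∀ i j N → + 1 ℤ.+ (+ 1 ℤ.+ (i ℤ.+ j) ℤ.- N) ≡ (+ 1 ℤ.+ i) ℤ.+ (+ 1 ℤ.+ j) ℤ.- N
  right = ℤ-Solver.solve-∀
  keep : ∀ i j N → i ℤ.- j ℤ.- N ≡ (+ 1 ℤ.+ i) ℤ.- (+ 1 ℤ.+ j) ℤ.- N
  keep = ℤ-Solver.solve-∀
  left : ∀ i j N → (- (+ 1)) ℤ.+ (+ 1 ℤ.+ (i ℤ.+ j) ℤ.- N) ≡ i ℤ.+ j ℤ.- N
  left = ℤ-Solver.solve-∀
  up : ∀ i j N → + 1 ℤ.+ (i ℤ.- j ℤ.- N) ≡ (+ 1 ℤ.+ i) ℤ.- j ℤ.- N
  up = ℤ-Solver.solve-∀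
  flat : ∀ i j N → (+ 1 ℤ.+ (i ℤ.+ j)) ℤ.- N ≡ i ℤ.+ (+ 1 ℤ.+ j) ℤ.- N
  flat = ℤ-Solver.solve-∀
  down : ∀ i j N → (- (+ 1)) ℤ.+ (i ℤ.- j ℤ.- N) ≡ i ℤ.- (+ 1 ℤ.+ j) ℤ.- N
  down = ℤ-Solver.solve-∀

neighbours-odd : ∀ n i j → neighbours (odd n (suc i) (suc j)) ≡
  even n (suc i) (suc j) ∷ even n i j ∷ even n (suc i) j ∷ even n i (suc j) ∷ []
neighbours-odd n i j =
  cong₂ _∷_ (cong₂ _,_ (right (+ i) (+ j) (+ suc n)) refl)
 (cong₂ _∷_ (cong₂ _,_ (left (+ i) (+ j) (+ suc n)) (keep (+ i) (+ j) (+ suc n)))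
 (cong₂ _∷_ (cong₂ _,_ (flat (+ i) (+ j) (+ suc n)) (up (+ i) (+ j) (+ suc n)))
 (cong₂ _∷_ (cong₂ _,_ refl (down (+ i) (+ j) (+ suc n))) refl)))
  where
  right : ∀ i j N → + 1 ℤ.+ (+ 1 ℤ.+ (i ℤ.+ (+ 1 ℤ.+ j)) ℤ.- N) ≡ + 1 ℤ.+ (+ 1 ℤ.+ (i ℤ.+ (+ 1 ℤ.+ j))) ℤ.- N
  right = ℤ-Solver.solve-∀
  left : ∀ i j N → (- (+ 1)) ℤ.+ (+ 1 ℤ.+ (i ℤ.+ (+ 1 ℤ.+ j)) ℤ.- N) ≡ + 1 ℤ.+ (i ℤ.+ j) ℤ.- N
  left = ℤ-Solver.solve-∀
  keep : ∀ i j N → (+ 1 ℤ.+ i) ℤ.- (+ 1 ℤ.+ j) ℤ.- N ≡ i ℤ.- j ℤ.- N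
  keep = ℤ-Solver.solve-∀
  flat : ∀ i j N → (+ 1 ℤ.+ (i ℤ.+ (+ 1 ℤ.+ j))) ℤ.- N ≡ (+ 1 ℤ.+ (+ 1 ℤ.+ (i ℤ.+ j))) ℤ.- N
  flat = ℤ-Solver.solve-∀
  up : ∀ i j N → + 1 ℤ.+ ((+ 1 ℤ.+ i) ℤ.- (+ 1 ℤ.+ j) ℤ.- N) ≡ (+ 1 ℤ.+ i) ℤ.- j ℤ.- N
  up = ℤ-Solver.solve-∀
  down : ∀ i j N → (- (+ 1)) ℤ.+ ((+ 1 ℤ.+ i) ℤ.- (+ 1 ℤ.+ j) ℤ.- N) ≡ i ℤ.- (+ 1 ℤ.+ j) ℤ.- N
  down = ℤ-Solver.solve-∀

L-odd : ∀ {n} (k : Fin (suc n)) → L k ≡ odd n (toℕ k) 0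
L-odd {n} k = cong₂ _,_
  (trans L≡ (cong (λ t → + t ℤ.- + suc n) (sym (+-identityʳ (toℕ k)))))
  (trans L≡ (cong (λ t → t ℤ.- + suc n) (sym (ℤ.+-identityʳ (+ toℕ k)))))
  where
  arith : ∀ m i → - m ≡ i ℤ.- (m ℤ.+ i)
  arith = ℤ-Solver.solve-∀
  L≡ : - (+ (suc n ∸ toℕ k)) ≡ + toℕ k ℤ.- + suc n
  L≡ = trans (arith (+ (suc n ∸ toℕ k)) (+ toℕ k))
             (cong (λ t → + toℕ k ℤ.- + t) (m∸n+n≡m (<⇒≤ (Fin.toℕ<n k))))

R-odd : ∀ {n} (k : Fin (suc n)) → R k ≡ odd n (suc n) (suc (toℕ k))
R-odd {n} k = cong₂ _,_ (arith₁ (+ suc (toℕ k)) (+ suc n)) (arith₂ (+ suc (toℕ k)) (+ suc n))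
  where
  arith₁ : ∀ k N → k ≡ N ℤ.+ k ℤ.- N
  arith₁ = ℤ-Solver.solve-∀
  arith₂ : ∀ k N → - k ≡ N ℤ.- k ℤ.- N
  arith₂ = ℤ-Solver.solve-∀

B-even : ∀ {n} (k : Fin (suc n)) → B k ≡ even n (toℕ k) (toℕ k)
B-even {n} k = cong₂ _,_
  (cong (λ t → + suc (toℕ k + t) ℤ.- + suc n) (+-identityʳ (toℕ k)))
  (arith (+ toℕ k) (+ suc n))
  where
  arith : ∀ k N → - N ≡ k ℤ.- k ℤ.- N
  arith = ℤ-Solver.solve-∀

InG-even : ∀ {n i j} → i ≤ n → j ≤ i → InG (suc n) (even n i j)
InG-even {n} {i} {j} i≤n j≤i =
  -- With `n = p + i` the row is `p + j + 1`, and the distances to its two ends are `2j + 1` and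
  -- `2p + 1`.
  subst (λ m → InG (suc m) (even m i j)) (m∸n+n≡m i≤n) (inG (n ∸ i))
  where
  height : ∀ p i j → i ℤ.- j ℤ.- (+ 1 ℤ.+ (p ℤ.+ i)) ≡ - (+ 1 ℤ.+ (p ℤ.+ j))
  height = ℤ-Solver.solve-∀
  left : ∀ p i j → + 1 ℤ.+ (i ℤ.+ j) ℤ.- (+ 1 ℤ.+ (p ℤ.+ i)) ≡ - (+ 1 ℤ.+ (p ℤ.+ j)) ℤ.+ (+ 1 ℤ.+ (j ℤ.+ j))
  left = ℤ-Solver.solve-∀
  right : ∀ p i j → + 1 ℤ.+ (p ℤ.+ j) ≡ + 1 ℤ.+ (i ℤ.+ j) ℤ.- (+ 1 ℤ.+ (p ℤ.+ i)) ℤ.+ (+ 1 ℤ.+ (p ℤ.+ p))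
  right = ℤ-Solver.solve-∀
  inG : ∀ p → InG (suc (p + i)) (even (p + i) i j)
  inG p = suc (p + j) , s≤s z≤n , s≤s (+-monoʳ-≤ p j≤i) , height (+ p) (+ i) (+ j) ,
    ≤-by (suc (j + j)) (left (+ p) (+ i) (+ j)) , ≤-by (suc (p + p)) (right (+ p) (+ i) (+ j))

InG-odd : ∀ {n i j} → suc i ≤ n → j ≤ i → InG (suc n) (odd n (suc i) (suc j))
InG-odd {n} {i} {j} i<n j≤i =
  subst (λ m → InG (suc m) (odd m (suc i) (suc j))) (m∸n+n≡m i<n) (inG (n ∸ suc i))
  where
  height : ∀ p i j → i ℤ.- j ℤ.- (+ 1 ℤ.+ (p ℤ.+ i)) ≡ - (+ 1 ℤ.+ (p ℤ.+ j))
  height = ℤ-Solver.solve-∀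
  left : ∀ p i j → i ℤ.+ j ℤ.- (+ 1 ℤ.+ (p ℤ.+ i)) ≡ - (+ 1 ℤ.+ (p ℤ.+ j)) ℤ.+ (j ℤ.+ j)
  left = ℤ-Solver.solve-∀
  right : ∀ p i j → + 1 ℤ.+ (p ℤ.+ j) ≡ i ℤ.+ j ℤ.- (+ 1 ℤ.+ (p ℤ.+ i)) ℤ.+ (+ 2 ℤ.+ (p ℤ.+ p))
  right = ℤ-Solver.solve-∀
  inG : ∀ p → InG (suc (p + suc i)) (odd (p + suc i) (suc i) (suc j))
  inG p = suc (p + suc j) , s≤s z≤n , s≤s (+-monoʳ-≤ p (s≤s j≤i)) , height (+ p) (+ suc i) (+ suc j) ,
    ≤-by (suc j + suc j) (left (+ p) (+ suc i) (+ suc j)) ,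
    ≤-by (suc (suc (p + p))) (right (+ p) (+ suc i) (+ suc j))

-- The difference of the coordinates is 0 on the left boundary and `2j + 1` at an even vertex.
even≢L : ∀ n i j (k : Fin (suc n)) → even n i j ≢ L k
even≢L n i j k eq with trans (arith (+ i) (+ j) (+ suc n))
  (trans (cong (λ (x , y) → x ℤ.- y) eq) (ℤ.+-inverseʳ (proj₁ (L k))))
  where
  arith : ∀ i j N → + 1 ℤ.+ (j ℤ.+ j) ≡ (+ 1 ℤ.+ (i ℤ.+ j)) ℤ.- N ℤ.- (i ℤ.- j ℤ.- N)
  arith = ℤ-Solver.solve-∀
... | ()

odd≢L : ∀ n i j (k : Fin (suc n)) → odd n i (suc j) ≢ L k
odd≢L n i j k eq with trans (arith (+ i) (+ suc j) (+ suc n))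
  (trans (cong (λ (x , y) → x ℤ.- y) eq) (ℤ.+-inverseʳ (proj₁ (L k))))
  where
  arith : ∀ i j N → j ℤ.+ j ≡ i ℤ.+ j ℤ.- N ℤ.- (i ℤ.- j ℤ.- N)
  arith = ℤ-Solver.solve-∀
... | ()

-- The sum of the coordinates is 0 on the right boundary and negative at the even vertices of
-- columns up to `n`.
even≢R : ∀ {n i} → i ≤ n → ∀ j (k : Fin (suc n)) → even n i j ≢ R k
even≢R {n} {i} i≤n j k eq with trans (arith (+ (n ∸ i)) (+ i) (+ j))
  (trans (cong (λ m → + suc (i + j) ℤ.- + suc m ℤ.+ (+ i ℤ.- + j ℤ.- + suc m)) (m∸n+n≡m i≤n))
  (trans (cong (λ (x , y) → x ℤ.+ y) eq) (ℤ.+-inverseʳ (proj₁ (R k)))))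
  where
  arith : ∀ p i j → - (+ 1 ℤ.+ (p ℤ.+ p)) ≡
    (+ 1 ℤ.+ (i ℤ.+ j)) ℤ.- (+ 1 ℤ.+ (p ℤ.+ i)) ℤ.+ (i ℤ.- j ℤ.- (+ 1 ℤ.+ (p ℤ.+ i)))
  arith = ℤ-Solver.solve-∀
... | ()

odd≢R : ∀ {n i} → i ≤ n → ∀ j (k : Fin (suc n)) → odd n i j ≢ R k
odd≢R {n} {i} i≤n j k eq with trans (arith (+ (n ∸ i)) (+ i) (+ j))
  (trans (cong (λ m → + (i + j) ℤ.- + suc m ℤ.+ (+ i ℤ.- + j ℤ.- + suc m)) (m∸n+n≡m i≤n))
  (trans (cong (λ (x , y) → x ℤ.+ y) eq) (ℤ.+-inverseʳ (proj₁ (R k)))))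
  where
  arith : ∀ p i j → - (+ 2 ℤ.+ (p ℤ.+ p)) ≡
    (i ℤ.+ j) ℤ.- (+ 1 ℤ.+ (p ℤ.+ i)) ℤ.+ (i ℤ.- j ℤ.- (+ 1 ℤ.+ (p ℤ.+ i)))
  arith = ℤ-Solver.solve-∀
... | ()

bottom-row : ∀ n i j → + i ℤ.- + j ℤ.- + suc n ≡ - (+ suc n) → i ≡ j
bottom-row n i j eq = ℤ.+-injective (trans (arith₁ (+ i) (+ j) (+ suc n))
  (trans (cong (λ t → t ℤ.+ + suc n ℤ.+ + j) eq) (arith₂ (+ j) (+ suc n))))
  where
  arith₁ : ∀ i j N → i ≡ (i ℤ.- j ℤ.- N) ℤ.+ N ℤ.+ j
  arith₁ = ℤ-Solver.solve-∀
  arith₂ : ∀ j N → - N ℤ.+ N ℤ.+ j ≡ j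
  arith₂ = ℤ-Solver.solve-∀

even≢B : ∀ {n i j} → j < i → (k : Fin (suc n)) → even n i j ≢ B k
even≢B {n} {i} {j} j<i k eq = <⇒≢ j<i (sym (bottom-row n i j (cong proj₂ eq)))

-- Lying on the bottom row forces `i = j`, and then the abscissae differ in parity.
odd≢B : ∀ n i j (k : Fin (suc n)) → odd n i j ≢ B k
odd≢B n i j k eq with bottom-row n i j (cong proj₂ eq)
... | refl = even≢odd i (toℕ k)
  (trans (cong (λ t → i + t) (+-identityʳ i)) (ℤ.+-injective (∙-cancelʳ (- (+ suc n)) _ _ (cong proj₁ eq))))

below∉G : ∀ {N x y} → y ≡ ℤ.pred (- (+ N)) → ¬ InG N (x , y)
below∉G {N} refl p = i≰pred-i (- (+ N)) (proj₁ (InG⇒bounds p))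

row-below : ∀ n i → + i ℤ.- + suc i ℤ.- + suc n ≡ ℤ.pred (- (+ suc n))
row-below n i = arith (+ i) (+ suc n)
  where
  arith : ∀ i N → i ℤ.- (+ 1 ℤ.+ i) ℤ.- N ≡ - (+ 1) ℤ.+ - N
  arith = ℤ-Solver.solve-∀

even-right : ∀ n j → ¬ InG (suc n) (even n (suc n) j)
even-right n j p = suc-i≰i (+ 0) (subst (ℤ._≤ + 0) (arith (+ suc n) (+ j)) (proj₂ (proj₂ (proj₂ (InG⇒bounds p)))))
  where
  arith : ∀ N j → + 1 ℤ.+ (N ℤ.+ j) ℤ.- N ℤ.+ (N ℤ.- j ℤ.- N) ≡ + 1
  arith = ℤ-Solver.solve-∀

odd-top : ∀ n → ¬ InG (suc n) (odd n (suc n) 0)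
odd-top n p = ℤ.<-irrefl (arith (+ suc n)) (proj₁ (proj₂ (InG⇒bounds p)))
  where
  arith : ∀ N → N ℤ.- + 0 ℤ.- N ≡ + 0
  arith = ℤ-Solver.solve-∀

left-above∉G : ∀ {N t x y} → x ≡ t → y ≡ t → ¬ InG N (ℤ.pred x , y) × ¬ InG N (x , ℤ.suc y)
left-above∉G {t = t} refl refl =
  (λ p → i≰pred-i t (proj₁ (proj₂ (proj₂ (InG⇒bounds p))))) ,
  (λ p → suc-i≰i t (proj₁ (proj₂ (proj₂ (InG⇒bounds p)))))

odd-left : ∀ n i → let (x , y) = odd n i 0 in ¬ InG (suc n) (ℤ.pred x , y) × ¬ InG (suc n) (x , ℤ.suc y)
odd-left n i = left-above∉G (cong (λ t → + t ℤ.- + suc n) (+-identityʳ i))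
                            (cong (λ t → t ℤ.- + suc n) (ℤ.+-identityʳ (+ i)))

-- Arcs between odd and even vertices

-- g p q says that the edge joining the odd vertex p to the even vertex q belongs to the class.
module ArcClass (n : ℕ) (g : Point → Point → Bool)
  (g-inG : ∀ {p q} → g p q ≡ true → InG (suc n) p × InG (suc n) q) where

  down left right up : ℕ → ℕ → ℕ
  down  i j = ind (g (odd n i (suc j)) (even n i j))
  left  i j = ind (g (odd n i j) (even n i j))
  right i j = ind (g (odd n (suc i) (suc j)) (even n i j))
  up    i j = ind (g (odd n (suc i) j) (even n i j))

  ∉G₁ : ∀ {p q} → ¬ InG (suc n) p → ind (g p q) ≡ 0
  ∉G₁ {p} {q} p∉ with g p q in eq
  ... | true  = contradiction (proj₁ (g-inG eq)) p∉
  ... | false = refl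

  ∉G₂ : ∀ {p q} → ¬ InG (suc n) q → ind (g p q) ≡ 0
  ∉G₂ {p} {q} q∉ with g p q in eq
  ... | true  = contradiction (proj₂ (g-inG eq)) q∉
  ... | false = refl

  evenDegree oddDegree : Point → ℕ
  evenDegree q = length (filterᵇ (λ p → g p q) (neighbours q))
  oddDegree  p = length (filterᵇ (g p) (neighbours p))

  evenDegree-even : ∀ i j → evenDegree (even n i j) ≡ down i j + (left i j + right i j + up i j)
  evenDegree-even i j =
    trans (cong (λ ps → length (filterᵇ (λ p → g p (even n i j)) ps)) (neighbours-even n i j))
   (trans (length-filterᵇ₄ (λ p → g p (even n i j))
            (odd n (suc i) (suc j)) (odd n i j) (odd n (suc i) j) (odd n i (suc j)))
          (arith (right i j) (left i j) (up i j) (down i j)))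
    where
    arith : ∀ r l u d → r + (l + (u + d)) ≡ d + (l + r + u)
    arith = solve-∀

  oddDegree-odd : ∀ i j → oddDegree (odd n (suc i) (suc j)) ≡
    down (suc i) j + left (suc i) (suc j) + (right i j + up i (suc j))
  oddDegree-odd i j =
    trans (cong (λ ps → length (filterᵇ (g (odd n (suc i) (suc j))) ps)) (neighbours-odd n i j))
   (trans (length-filterᵇ₄ (g (odd n (suc i) (suc j)))
            (even n (suc i) (suc j)) (even n i j) (even n (suc i) j) (even n i (suc j)))
          (arith (left (suc i) (suc j)) (right i j) (down (suc i) j) (up i (suc j))))
    where
    arith : ∀ l r d u → l + (r + (d + u)) ≡ d + l + (r + u)
    arith = solve-∀

  down-bottom : ∀ i → down i i ≡ 0
  down-bottom i = ∉G₁ (below∉G (row-below n i))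

  up-bottom : ∀ i → up i (suc i) ≡ 0
  up-bottom i = ∉G₂ (below∉G (row-below n i))

  up-top : up n 0 ≡ 0
  up-top = ∉G₁ (odd-top n)

  oddDegree-right : ∀ j → oddDegree (odd n (suc n) (suc j)) ≡ right n j + up n (suc j)
  oddDegree-right j = trans (oddDegree-odd n j)
    (cong₂ (λ d l → d + l + (right n j + up n (suc j))) (∉G₂ (even-right n j)) (∉G₂ (even-right n (suc j))))

  -- The lower neighbour stays in raw coordinates: it is the even vertex `(i - 1 , 0)` for positive
  -- `i` and lies outside the graph for `i = 0`.
  oddDegree-left : ∀ i → let (x , y) = odd n i 0 in
    oddDegree (odd n i 0) ≡ left i 0 + ind (g (x , y) (x , ℤ.pred y))
  oddDegree-left i =
    let p = odd n i 0
        (x , y) = p in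
    trans (length-filterᵇ₄ (g p) (ℤ.suc x , y) (ℤ.pred x , y) (x , ℤ.suc y) (x , ℤ.pred y))
   (cong₂ _+_ (cong (λ t → ind (g p (t , y))) (arith (+ (i + 0)) (+ suc n)))
     (cong₂ (λ l u → l + (u + ind (g p (x , ℤ.pred y))))
       (∉G₂ (proj₁ (odd-left n i))) (∉G₂ (proj₂ (odd-left n i)))))
    where
    arith : ∀ i N → + 1 ℤ.+ (i ℤ.- N) ≡ + 1 ℤ.+ i ℤ.- N
    arith = ℤ-Solver.solve-∀

  oddDegree-left-zero : oddDegree (odd n 0 0) ≡ left 0 0
  oddDegree-left-zero = trans (oddDegree-left 0)
    (trans (cong (_+_ (left 0 0)) (∉G₂ (below∉G (arith (+ suc n))))) (+-identityʳ (left 0 0)))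
    where
    arith : ∀ N → - (+ 1) ℤ.+ (+ 0 ℤ.- + 0 ℤ.- N) ≡ - (+ 1) ℤ.+ - N
    arith = ℤ-Solver.solve-∀

  oddDegree-left-suc : ∀ i → oddDegree (odd n (suc i) 0) ≡ left (suc i) 0 + up i 0
  oddDegree-left-suc i = trans (oddDegree-left (suc i))
    (cong (λ t → left (suc i) 0 + ind (g (odd n (suc i) 0) (+ suc (i + 0) ℤ.- + suc n , t)))
      (arith (+ i) (+ suc n)))
    where
    arith : ∀ i N → - (+ 1) ℤ.+ ((+ 1 ℤ.+ i) ℤ.- + 0 ℤ.- N) ≡ i ℤ.- + 0 ℤ.- N
    arith = ℤ-Solver.solve-∀

ind≤1 : ∀ b → ind b ≤ 1
ind≤1 true  = s≤s z≤n
ind≤1 false = z≤n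

length-filterᵇ-+ : ∀ {A : Set} (f g h : A → Bool) → (∀ x → ind (f x) ≡ ind (g x) + ind (h x)) →
  ∀ xs → length (filterᵇ f xs) ≡ length (filterᵇ g xs) + length (filterᵇ h xs)
length-filterᵇ-+ f g h f≡ []       = refl
length-filterᵇ-+ f g h f≡ (x ∷ xs) =
  trans (length-filterᵇ-∷ f x xs)
 (trans (cong₂ _+_ (f≡ x) (length-filterᵇ-+ f g h f≡ xs))
 (trans (arith (ind (g x)) (ind (h x)) (length (filterᵇ g xs)) (length (filterᵇ h xs)))
        (sym (cong₂ _+_ (length-filterᵇ-∷ g x xs) (length-filterᵇ-∷ h x xs)))))
  where
  arith : ∀ a b c d → a + b + (c + d) ≡ a + c + (b + d)
  arith = solve-∀

length-filterᵇ-none : ∀ {A : Set} (f : A → Bool) → (∀ x → f x ≡ false) → ∀ xs → length (filterᵇ f xs) ≡ 0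
length-filterᵇ-none f f≡ []       = refl
length-filterᵇ-none f f≡ (x ∷ xs) = trans (length-filterᵇ-∷ f x xs)
  (cong₂ _+_ (cong ind (f≡ x)) (length-filterᵇ-none f f≡ xs))

each-index : ∀ {n} (P : ℕ → Set) → (∀ (k : Fin (suc n)) → P (toℕ k)) → ∀ {i} → i ≤ n → P i
each-index P p i≤n = subst P (Fin.toℕ-fromℕ< (s≤s i≤n)) (p (fromℕ< (s≤s i≤n)))

+≡1⇒1∸ : ∀ {a b} → a + b ≡ 1 → 1 ∸ b ≡ a
+≡1⇒1∸ {a} {b} eq = trans (cong (λ t → t ∸ b) (sym eq)) (m+n∸n≡m a b)

-- The matching pair of an oriented TFPL

module _ {n : ℕ} (f : OrientedTFPL (suc n)) {u v w : Word (suc n)} (bd : HasBoundary f u v w) where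
  open OrientedTFPL f
  open HasBoundary bd

  arc-inG : ∀ {p q} → arc p q ≡ true → InG (suc n) p × InG (suc n) q
  arc-inG a = let (p∈ , q∈ , _) = edge-inG (arc-edge a) in p∈ , q∈

  edge≡arcs : ∀ p q → ind (edge p q) ≡ ind (arc p q) + ind (arc q p)
  edge≡arcs p q with edge p q in e | arc p q in a | arc q p in a′
  ... | true  | true  | false = refl
  ... | true  | false | true  = refl
  ... | true  | true  | true  =
    contradiction (trans (sym (cong₂ _xor_ a a′)) (edge-one-arc e)) λ ()
  ... | true  | false | false =
    contradiction (trans (sym (cong₂ _xor_ a a′)) (edge-one-arc e)) λ ()
  ... | false | true  | _     = contradiction (trans (sym e) (arc-edge a)) λ ()
  ... | false | false | true  =
    contradiction (trans (sym e) (trans (edge-sym p q) (arc-edge a′))) λ ()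
  ... | false | false | false = refl

  arcs-disjoint : ∀ p q → ind (arc p q) + ind (arc q p) ≤ 1
  arcs-disjoint p q = subst (_≤ 1) (edge≡arcs p q) (ind≤1 (edge p q))

  degree≡ : ∀ p → degree p ≡ outdegree p + indegree p
  degree≡ p = length-filterᵇ-+ (edge p) (arc p) (λ q → arc q p) (edge≡arcs p) (neighbours p)

  arc⇒¬reverse : ∀ {p q} → arc p q ≡ true → arc q p ≡ false
  arc⇒¬reverse {p} {q} a with arc p q | arc q p | arcs-disjoint p q
  arc⇒¬reverse refl | _ | false | _      = refl
  arc⇒¬reverse refl | _ | true  | s≤s ()

  no-arc-into-L : ∀ k q → arc q (L k) ≡ false
  no-arc-into-L k q with arc q (L k) in a
  ... | false = refl
  ... | true  = trans (sym a) (arc⇒¬reverse (L-out k q (trans (edge-sym (L k) q) (arc-edge a))))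

  no-arc-from-R : ∀ k q → arc (R k) q ≡ false
  no-arc-from-R k q with arc (R k) q in a
  ... | false = refl
  ... | true  = trans (sym a) (arc⇒¬reverse (R-in k q (trans (edge-sym q (R k)) (arc-edge a))))

  indegree-L : ∀ k → indegree (L k) ≡ 0
  indegree-L k = length-filterᵇ-none _ (no-arc-into-L k) (neighbours (L k))

  outdegree-R : ∀ k → outdegree (R k) ≡ 0
  outdegree-R k = length-filterᵇ-none _ (no-arc-from-R k) (neighbours (R k))

  outdegree-L : ∀ k → outdegree (L k) ≡ bit u (toℕ k)
  outdegree-L k = trans (trans (sym (+-identityʳ _)) (sym (trans (degree≡ (L k)) (cong (_+_ (outdegree (L k))) (indegree-L k)))))
                        (trans lemma (sym (bit-lookup u k)))
    where
    lemma : degree (L k) ≡ toℕ (lookup u k)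
    lemma with degree-L k
    ... | inj₂ deg≡1 = trans deg≡1 (cong toℕ (sym (Equivalence.from (boundary-L k) deg≡1)))
    ... | inj₁ deg≡0 with lookup u k in eq
    ...   | zero     = deg≡0
    ...   | suc zero = contradiction (trans (sym deg≡0) (Equivalence.to (boundary-L k) eq)) λ ()

  indegree-R : ∀ k → indegree (R k) + bit v (toℕ k) ≡ 1
  indegree-R k = trans (cong₂ _+_ (sym (trans (degree≡ (R k)) (cong (λ t → t + indegree (R k)) (outdegree-R k))))
                                  (bit-lookup v k)) lemma
    where
    lemma : degree (R k) + toℕ (lookup v k) ≡ 1
    lemma with degree-R k
    ... | inj₂ deg≡1 = cong₂ (λ a x → a + toℕ x) deg≡1 (Equivalence.from (boundary-R k) deg≡1)
    ... | inj₁ deg≡0 with lookup v k in eq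
    ...   | suc zero = cong (λ a → a + 1) deg≡0
    ...   | zero     = contradiction (trans (sym deg≡0) (Equivalence.to (boundary-R k) eq)) λ ()

  degrees-B : ∀ k → indegree (B k) ≡ bit w (toℕ k) × outdegree (B k) + bit w (toℕ k) ≡ 1
  degrees-B k rewrite bit-lookup w k
    with outdegree (B k) | indegree (B k) | trans (sym (degree≡ (B k))) (degree-B k)
       | boundary-B-in k | boundary-B-out k
  ... | 0 | 1 | refl | w≡1 | _   = cong toℕ (sym (w≡1 refl)) , cong toℕ (w≡1 refl)
  ... | 1 | 0 | refl | _   | w≡0 = cong toℕ (sym (w≡0 refl)) , cong (λ x → suc (toℕ x)) (w≡0 refl)

  -- Strictness of `j < i` keeps off the bottom row, whose even vertices have degree 1.
  even-balanced : ∀ {i j} → i ≤ n → j < i → indegree (even n i j) ≡ 1 × outdegree (even n i j) ≡ 1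
  even-balanced {i} {j} i≤n j<i = balanced _
    (degree-other _ (InG-even i≤n (<⇒≤ j<i)) (even≢L n i j) (even≢R i≤n j) (even≢B j<i))

  odd-balanced : ∀ {i j} → suc i ≤ n → j ≤ i →
    indegree (odd n (suc i) (suc j)) ≡ 1 × outdegree (odd n (suc i) (suc j)) ≡ 1
  odd-balanced {i} {j} i<n j≤i = balanced _
    (degree-other _ (InG-odd i<n j≤i) (odd≢L n (suc i) j) (odd≢R i<n (suc j)) (odd≢B n (suc i) (suc j)))

  reverse : Point → Point → Bool
  reverse p q = arc q p

  reverse-inG : ∀ {p q} → reverse p q ≡ true → InG (suc n) p × InG (suc n) q
  reverse-inG a = let (q∈ , p∈) = arc-inG a in p∈ , q∈

  -- The arcs from odd to even vertices and those from even to odd vertices, respectively.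
  module Out = ArcClass n arc arc-inG
  module In  = ArcClass n reverse reverse-inG

  -- The lower neighbour is left out so that the complements to 1 can serve as `D₁` and `D₂`: they
  -- are the true indicators in the interior and the substitutes at the bottom.
  restOut restIn : ℕ → ℕ → ℕ
  restOut i j = Out.left i j + Out.right i j + Out.up i j
  restIn  i j = In.left i j + In.right i j + In.up i j

  interior-Out : ∀ {i j} → i ≤ n → j < i → Out.down i j + restOut i j ≡ 1
  interior-Out {i} {j} i≤n j<i = trans (sym (Out.evenDegree-even i j)) (proj₁ (even-balanced i≤n j<i))

  interior-In : ∀ {i j} → i ≤ n → j < i → In.down i j + restIn i j ≡ 1
  interior-In {i} {j} i≤n j<i = trans (sym (In.evenDegree-even i j)) (proj₂ (even-balanced i≤n j<i))

  bottom-Out : ∀ {i} → i ≤ n → restOut i i ≡ bit w i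
  bottom-Out = each-index (λ i → restOut i i ≡ bit w i) λ k → let i = toℕ k in
    trans (cong (λ t → t + restOut i i) (sym (Out.down-bottom i)))
   (trans (sym (Out.evenDegree-even i i))
   (trans (cong indegree (sym (B-even k))) (proj₁ (degrees-B k))))

  bottom-In : ∀ {i} → i ≤ n → restIn i i + bit w i ≡ 1
  bottom-In = each-index (λ i → restIn i i + bit w i ≡ 1) λ k → let i = toℕ k in
    trans (cong (λ t → t + restIn i i + bit w i) (sym (In.down-bottom i)))
   (trans (cong (λ t → t + bit w i) (sym (In.evenDegree-even i i)))
   (trans (cong (λ p → outdegree p + bit w i) (sym (B-even k))) (proj₂ (degrees-B k))))

  restOut≤1 : ∀ {i j} → i ≤ n → j ≤ i → restOut i j ≤ 1
  restOut≤1 {i} {j} i≤n j≤i with m≤n⇒m<n∨m≡n j≤i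
  ... | inj₁ j<i  = subst (restOut i j ≤_) (interior-Out i≤n j<i) (m≤n+m _ (Out.down i j))
  ... | inj₂ refl = subst (restOut i i ≤_) (trans (cong (λ t → t + restIn i i) (bottom-Out i≤n))
                                              (trans (+-comm (bit w i) (restIn i i)) (bottom-In i≤n)))
                          (m≤m+n (restOut i i) (restIn i i))

  restIn≤1 : ∀ {i j} → i ≤ n → j ≤ i → restIn i j ≤ 1
  restIn≤1 {i} {j} i≤n j≤i with m≤n⇒m<n∨m≡n j≤i
  ... | inj₁ j<i  = subst (restIn i j ≤_) (interior-In i≤n j<i) (m≤n+m _ (In.down i j))
  ... | inj₂ refl = subst (restIn i i ≤_) (bottom-In i≤n) (m≤m+n _ _)

  downOut≡ : ∀ {i j} → i ≤ n → j < i → 1 ∸ restOut i j ≡ Out.down i j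
  downOut≡ i≤n j<i = +≡1⇒1∸ (interior-Out i≤n j<i)

  downIn≡ : ∀ {i j} → i ≤ n → j < i → 1 ∸ restIn i j ≡ In.down i j
  downIn≡ i≤n j<i = +≡1⇒1∸ (interior-In i≤n j<i)

  odd-In : ∀ {i j} → suc i ≤ n → j ≤ i →
    In.down (suc i) j + In.left (suc i) (suc j) + (In.right i j + In.up i (suc j)) ≡ 1
  odd-In {i} {j} i<n j≤i = trans (sym (In.oddDegree-odd i j)) (proj₁ (odd-balanced i<n j≤i))

  right-In : ∀ {j} → j ≤ n → bit v j + (In.right n j + In.up n (suc j)) ≡ 1
  right-In = each-index (λ j → bit v j + (In.right n j + In.up n (suc j)) ≡ 1) λ k →
    trans (cong (_+_ (bit v (toℕ k))) (sym (In.oddDegree-right (toℕ k))))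
   (trans (+-comm (bit v (toℕ k)) _)
   (trans (cong (λ p → indegree p + bit v (toℕ k)) (sym (R-odd k))) (indegree-R k)))

  -- The bound comes from the odd vertex `(suc i , suc j)`, which has degree 2 for `i < n` and lies
  -- on the right boundary for `i = n`.
  redLeaving : ∀ {i j} → i ≤ n → j ≤ i → In.right i j + In.up i (suc j) ≤ 1
  redLeaving {i} {j} i≤n j≤i with m≤n⇒m<n∨m≡n i≤n
  ... | inj₁ i<n  = subst (In.right i j + In.up i (suc j) ≤_) (odd-In i<n j≤i) (m≤n+m _ (In.down (suc i) j + In.left (suc i) (suc j)))
  ... | inj₂ refl = subst (In.right i j + In.up i (suc j) ≤_) (right-In j≤i) (m≤n+m _ (bit v j))

  left-Out-zero : Out.left 0 0 ≡ bit u 0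
  left-Out-zero = trans (sym Out.oddDegree-left-zero)
    (trans (cong outdegree (sym (L-odd {n} zero))) (outdegree-L zero))

  outdegree-left : ∀ {i} → i ≤ n → outdegree (odd n i 0) ≡ bit u i
  outdegree-left = each-index (λ i → outdegree (odd n i 0) ≡ bit u i) λ k →
    trans (cong outdegree (sym (L-odd k))) (outdegree-L k)

  no-arc-into-left : ∀ {i} → i ≤ n → ∀ q → arc q (odd n i 0) ≡ false
  no-arc-into-left = each-index (λ i → ∀ q → arc q (odd n i 0) ≡ false) λ k q →
    subst (λ p → arc q p ≡ false) (L-odd k) (no-arc-into-L k q)

  no-arc-from-right : ∀ {j} → j ≤ n → ∀ q → arc (odd n (suc n) (suc j)) q ≡ false
  no-arc-from-right = each-index (λ j → ∀ q → arc (odd n (suc n) (suc j)) q ≡ false) λ k q →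
    subst (λ p → arc p q ≡ false) (R-odd k) (no-arc-from-R k q)

  up-In-left : ∀ {i} → i ≤ n → In.up i 0 ≡ 0
  up-In-left {i} i≤n with m≤n⇒m<n∨m≡n i≤n
  ... | inj₁ i<n  = cong ind (no-arc-into-left i<n (even n i 0))
  ... | inj₂ refl = In.up-top

  up-Out-right : ∀ {j} → j ≤ n → Out.up n j ≡ 0
  up-Out-right {zero}  _   = Out.up-top
  up-Out-right {suc j} j<n = cong ind (no-arc-from-right (<⇒≤ j<n) (even n n (suc j)))

  -- In the interior the two terms indicate opposite orientations of one edge; at the bottom they
  -- are `1 - w i` and `w i`.
  disjoint-downs : ∀ {i j} → i ≤ n → j ≤ i → (1 ∸ restOut i j) + (1 ∸ restIn i j) ≤ 1
  disjoint-downs {i} {j} i≤n j≤i with m≤n⇒m<n∨m≡n j≤i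
  ... | inj₁ j<i  = subst (_≤ 1) (sym (cong₂ _+_ (downOut≡ i≤n j<i) (downIn≡ i≤n j<i)))
                          (arcs-disjoint (odd n i (suc j)) (even n i j))
  ... | inj₂ refl = ≤-reflexive (trans
    (cong₂ _+_ (cong (λ t → 1 ∸ t) (bottom-Out i≤n)) (+≡1⇒1∸ (trans (+-comm (bit w i) _) (bottom-In i≤n))))
    (m∸n+n≡m (subst (_≤ 1) (bottom-Out i≤n) (restOut≤1 i≤n ≤-refl))))

  matchingPair : MatchingPair n (bit u) (bit v) (bit w)
  matchingPair = record
    { D₁ = λ i j → 1 ∸ restOut i j ; L₁ = Out.left ; R₁ = Out.right ; U₁ = Out.up
    ; D₂ = λ i j → 1 ∸ restIn i j  ; L₂ = In.left  ; R₂ = In.right  ; U₂ = In.up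
    -- The complement counts the arcs into the odd vertex from column `suc i` when `i < n`, and
    -- yields `v` when `i = n`.
    ; z  = λ i j → 1 ∸ (In.right i j + In.up i (suc j))
    ; even₁ = λ i≤n j≤i → m∸n+n≡m (restOut≤1 i≤n j≤i)
    ; even₂ = λ i≤n j≤i → m∸n+n≡m (restIn≤1 i≤n j≤i)
    ; odd₁ = λ {i} {j} i<n j≤i →
        trans (cong (λ t → t + Out.left (suc i) (suc j) + (Out.right i j + Out.up i (suc j)))
                    (downOut≡ i<n (s≤s j≤i)))
       (trans (sym (Out.oddDegree-odd i j)) (proj₂ (odd-balanced i<n j≤i)))
    ; odd₂ = λ {i} {j} i<n j≤i →
        trans (cong (λ t → t + In.left (suc i) (suc j)) (downIn≡ i<n (s≤s j≤i)))
              (sym (+≡1⇒1∸ (odd-In i<n j≤i)))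
    ; z-law = λ i≤n j≤i → m∸n+n≡m (redLeaving i≤n j≤i)
    ; left₁-0 = left-Out-zero
    ; left₁ = λ {i} i<n → trans (sym (Out.oddDegree-left-suc i)) (outdegree-left i<n)
    ; left₂ = λ {i} i≤n → cong₂ _+_ (cong ind (no-arc-into-left i≤n (even n i 0))) (up-In-left i≤n)
    ; right₁ = λ {j} j≤n → cong₂ _+_ (cong ind (no-arc-from-right j≤n (even n n j))) (up-Out-right j≤n)
    ; right₂ = λ j≤n → +≡1⇒1∸ (right-In j≤n)
    ; outside₁ = λ {i} _ → Out.up-bottom i
    ; outside₂ = λ {i} _ → In.up-bottom i
    ; bottom₁ = λ {i} i≤n → trans (cong (_+_ (1 ∸ restOut i i)) (sym (bottom-Out i≤n)))
                                  (m∸n+n≡m (restOut≤1 i≤n ≤-refl))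
    ; bottom₂ = λ {i} i≤n → +≡1⇒1∸ (trans (+-comm (bit w i) _) (bottom-In i≤n))
    ; disjoint = disjoint-downs
    }

-- From prefix sums back to words

zeros-≡ : ∀ {N} (u v : Word N) → sum N (bit u) ≡ sum N (bit v) → ∣ u ∣₀ ≡ ∣ v ∣₀
zeros-≡ u v eq = +-cancelʳ-≡ ∣ u ∣₁ _ _ (trans (zeros+ones u)
  (trans (sym (zeros+ones v)) (cong (_+_ ∣ v ∣₀) (trans (ones v) (trans (sym eq) (sym (ones u)))))))

≼-prefix : ∀ {N} (u v : Word N) → (∀ m → m ≤ N → sum m (bit u) ≤ sum m (bit v)) → u ≼ v
≼-prefix u v u≤v i i≤N = subst₂ _≤_ (sym (ones-truncate i≤N u)) (sym (ones-truncate i≤N v)) (u≤v i i≤N)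

-- With equally many 1s the triangular parts of the areas cancel.
d-area : ∀ {N} (u w : Word N) k → sum N (bit u) ≡ sum N (bit w) → area u + k ≡ area w → d u + k ≡ d w
d-area u w k eq area≡ = +-cancelʳ-≡ (triangular ∣ w ∣₁) _ _
  (trans (arith (d u) k (triangular ∣ w ∣₁))
  (trans (cong (λ t → d u + triangular t + k) (trans (ones w) (trans (sym eq) (sym (ones u)))))
  (trans (cong (λ t → t + k) (sym (area-d u))) (trans area≡ (area-d w)))))
  where
  arith : ∀ d k t → d + k + t ≡ d + t + k
  arith = solve-∀

theorem3p1 : (N : ℕ) → 1 ≤ N → (u v w : Word N) →
    (∃[ f ] HasBoundary {N} f u v w) →
    (∣ u ∣₀ ≡ ∣ v ∣₀ × ∣ v ∣₀ ≡ ∣ w ∣₀) ×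
    (u ≼ w × v ≼ w) ×
    d u + d v ≤ d w
theorem3p1 (suc n) _ u v w (f , bd) =
  (zeros-≡ u v (trans (u-total M) (sym (v-total M))) , zeros-≡ v w (v-total M)) ,
  (≼-prefix u w (u≤w M) , ≼-prefix v w (v≤w M)) ,
  -- Since `d u + s` and `d v + q` both equal `d w`, adding `d w` to both sides reduces the claim to
  -- `d w ≤ s + q`.
  +-cancelʳ-≤ (d w) _ _ (begin
    d u + d v + d w          ≤⟨ +-monoʳ-≤ (d u + d v) d-w ⟩
    d u + d v + (s + q)      ≡⟨ arith (d u) (d v) s q ⟩
    (d u + s) + (d v + q)    ≡⟨ cong₂ _+_ (d-area u w s (u-total M) (u-area M)) (d-area v w q (v-total M) (v-area M)) ⟩
    d w + d w                ∎)
  where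
  open ≤-Reasoning
  M = matchingPair f bd
  s = sum (suc n) (S M)
  q = sum (suc n) (Q M)
  arith : ∀ a b s q → a + b + (s + q) ≡ (a + s) + (b + q)
  arith = solve-∀
  d-w : d w ≤ s + q
  d-w = subst (_≤ s + q)
    (trans (sum-cong (suc n) (λ { {i} (s≤s i≤n) → cong (_* sum (suc i) (bit w))
              (sym (+≡1⇒1∸ {MatchingPair.D₁ M i i} (MatchingPair.bottom₁ M i≤n))) }))
           (sym (d-prefix w)))
    (w-bound M)
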